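{- Let $(A,B)$ be an interpolation problem. Let $a+b\le c$ be a mixed literal with auxiliary variable $x_2$, and let $x_1$ be the auxiliary variable of the negated literal $\lnot(a+b\le c)$. Suppose that $I_1[LA(c_1x_1+s_1(\vec x),k_1,F_1(x_1,\vec x))]$ is a partial interpolant of the clause $C_1\lor a+b\le c$ and that $I_2[LA(c_2x_2+s_2(\vec x),k_2,F_2(x_2,\vec x))]$ is a partial interpolant of the clause $C_2\lor\lnot(a+b\le c)$, where the displayed $LA$-sub-formulae occur only positively, $x_1$ (respectively $x_2$) occurs in the first (respectively second) partial interpolant only inside the displayed $LA$-sub-formula, and $\vec x$ denotes the other auxiliary variables of mixed inequality literals. Let $$s_3(\vec x):=c_2s_1(\vec x)+c_1s_2(\vec x).$$ In the integer case let $k_3:=c_2k_1+c_1k_2+c_1c_2$ and $$F_3(\vec x):\equiv\bigvee_{i=0}^{\left\lceil\frac{k_1+1}{c_1}\right\rceil}F_1\!\left(\left\lfloor\tfrac{ -s_1(\vec x)}{c_1}\right\rfloor-i,\vec x\right)\land F_2\!\left(i-\left\lfloor\tfrac{ -s_1(\vec x)}{c_1}\right\rfloor,\vec x\right).$$ In the real case let, if $k_1=-\varepsilon$, $k_3:=k_2$ and $F_3(\vec x):\equiv F_2\!\left(\tfrac{s_1(\vec x)}{c_1},\vec x\right)$; and, if $k_1=0$, $k_3:=0$ and $F_3(\vec x):\equiv s_3(\vec x)<0\lor\left(F_1\!\left(-\tfrac{s_1(\vec x)}{c_1},\vec x\right)\land F_2\!\left(\tfrac{s_1(\vec x)}{c_1},\vec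 x\right)\right)$. Then $I_1[I_2[LA(s_3(\vec x),k_3,F_3(\vec x))]]$ is a partial interpolant of the clause $C_1\lor C_2$.
   Context: Formulae are quantifier-free first-order formulae in the combined theory of equality with uninterpreted functions and linear arithmetic over $\mathbb{Q}$ and $\mathbb{Z}$ (with the integer division-by-constant functions $\lfloor\cdot/k\rfloor$, $k\ge 1$, in the signature); $\models$ is entailment in this theory. $\mathrm{symb}(F)$ is the set of non-theory symbols of $F$. An interpolation problem is a pair $(A,B)$ of formulae with $A\land B\models\bot$. A symbol is shared if it is in $\mathrm{symb}(A)\cap\mathrm{symb}(B)$, $A$-local if in $\mathrm{symb}(A)\setminus\mathrm{symb}(B)$, $B$-local if in $\mathrm{symb}(B)\setminus\mathrm{symb}(A)$. A term/literal is $A$-local ($B$-local) if it contains at least one $A$-local ($B$-local) symbol and no $B$-local ($A$-local) symbol, shared if it contains only shared symbols, mixed if it contains both $A$-local and $B$-local symbols. Arithmetic. In the integer case all variables and terms are integer-valued, inequality literals are $s\le c$ with $s$ a linear combination with integer coefficients and $c\in\mathbb{Z}$, and $s<c$ means $s\le c-1$. In the real case variables range over $\mathbb{Q}$ and constants over $\mathbb{Q}_\varepsilon=\mathbb{Q}\cup\{q-\varepsilon\mid q\in\mathbb{Q}\}$, where $s\le q-\varepsilon$ means $s<q$; accordingly "$s<\varepsilon$" means $s\le 0$. In the integer case $-\varepsilon$ stands for $-1$. For readability, $s > 0$, $s<-k$ etc. are used in this sense. Projections. Each literal $\ell$ has projections $\ell\downharpoonright A$, $\ell\downharpoonright B$,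 extended to conjunctions of literals component-wise. For non-mixed literals: if $\ell$ is $A$-local, $\ell\downharpoonright A=\ell$ and $\ell\downharpoonright B=\top$; if $\ell$ is $B$-local, $\ell\downharpoonright A=\top$ and $\ell\downharpoonright B=\ell$; if $\ell$ is shared, then either (Pudlák) $\ell\downharpoonright A=\ell\downharpoonright B=\ell$, or (McMillan) $\ell\downharpoonright A=\top$, $\ell\downharpoonright B=\ell$, the choice being fixed throughout. For mixed literals, fresh auxiliary variables are used: for $a$ $A$-local and $b$ $B$-local, $(a=b)\downharpoonright A := (a=x)$, $(a=b)\downharpoonright B := (x=b)$, $(a\neq b)\downharpoonright A := (p_x \mathrel{\mathrm{xor}} (a=x))$, $(a\neq b)\downharpoonright B := (\lnot p_x \mathrel{\mathrm{xor}} (x=b))$ ($p_x$ Boolean); for a mixed inequality $a+b\le c$, where $a$ is a linear combination of $A$-local variables, $b$ a linear combination of $B$-local and shared variables and $c$ a constant, with auxiliary variable $x$: $(a+b\le c)\downharpoonright A := (a+x\le 0)$ and $(a+b\le c)\downharpoonright B := (-x+b\le c)$. The negation of a mixed inequality is again a mixed inequality and has a different auxiliary variable. Thus for the pivot here: $(a+b\le c)\downharpoonright A=(a+x_2\le0)$, $(a+b\le c)\downharpoonright B=(-x_2+b\le c)$, $\lnot(a+b\le c)\downharpoonright A=(-a+x_1\le0)$, $\lnot(a+b\le c)\downharpoonright B=(-x_1-b<-c)$, i.e. $\lnot(x_1+b\le c)$. Auxiliary variables belonging to different literals are distinct (except that $a=b$ and $a\ne b$ share $x$), are fresh (do not occur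 in $A$, $B$ or the clauses), have the same type as the terms in the literal, and count as shared symbols. Partial interpolant. A partial interpolant of a clause $C$ is a formula $I$ that is an interpolant of $A\land(\lnot C\downharpoonright A)$ and $B\land(\lnot C\downharpoonright B)$, i.e. (i) $A\land\lnot C\downharpoonright A\models I$, (ii) $B\land\lnot C\downharpoonright B\land I\models\bot$, (iii) every non-theory symbol of $I$ is in $\mathrm{symb}(A)\cap\mathrm{symb}(B)$ or is an auxiliary variable introduced by the projections of the literals of $\lnot C$. $LA$-pattern. The expression $LA(s(\vec y),k,F(\vec y))$, where $\vec y$ is a vector of auxiliary variables, denotes the formula $F(\vec y)$ and merely records $s$ and $k$. It is only used when: $s$ is a linear term over $\vec y$ and arbitrary other terms not involving $\vec y$, in which the coefficients of the variables $\vec y$ are positive (so in particular $c_1,c_2>0$); $k\in\{0,-\varepsilon\}$ in the real case and $k\in\mathbb{Z}$, $k\ge-1$ in the integer case; $F$ is monotone, i.e. $\vec y\ge\vec y'$ (component-wise) implies $F(\vec y)\rightarrow F(\vec y')$; $F(\vec y)=\bot$ whenever $s(\vec y)>0$; and $F(\vec y)=\top$ whenever $s(\vec y)<-k$. In a partial interpolant, auxiliary variables of mixed inequality literals occur only inside such $LA$-sub-formulae. $F[G]$ denotes a formula in negation normal form with a sub-formula $G$ occurring positively; $F[G']$ is the result of replacing $G$ by $G'$. $C_1,C_2$ contain neither the pivot literal nor its negation.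
   Formalization: Condition (iii) is read as also covering the symbols of the term s recorded in each LA-pattern (assumed of both premises, proved for the result); otherwise F_3, which contains s_1, could contain a local symbol absent from F_1, making the claim false. -}

module Defs where

open import Data.Bool.Base using (Bool; T)
open import Data.Empty using (⊥)
open import Data.Integer.Base as ℤ using (ℤ; +_; +[1+_]; -[1+_]; +<+)
open import Data.List.Base using (List; []; _∷_; _++_; map; filter; foldr; upTo; concatMap)
open import Data.List.Properties using (≡-dec)
open import Data.List.Membership.Propositional using (_∈_; _∉_)
open import Data.List.Relation.Unary.All using (All; []; _∷_)
open import Data.List.Relation.Unary.Any using (any?)
open import Data.Maybe.Base using (Maybe; just; nothing)
open import Data.Nat.Base as ℕ using (ℕ; suc; s≤s; z≤n)
open import Data.Product using (Σ-syntax; ∃-syntax; _×_; _,_; proj₁; proj₂)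
open import Data.Rational.Base as ℚ using (ℚ; 0ℚ; 1ℚ; 1/_)
open import Data.Sum.Base using (_⊎_)
open import Data.Unit.Base using (⊤)
open import Function.Definitions using (Injective)
open import Relation.Binary.Definitions using (DecidableEquality)
open import Relation.Binary.PropositionalEquality using (_≡_; _≢_; refl)
open import Relation.Nullary using (Dec; yes; no; ¬_; ¬?; _×-dec_)
import Data.List.Membership.DecPropositional as DecMembership
import Data.Nat.Properties as ℕ
import Data.Rational.Properties as ℚ

data Arith : Set where
  int rat : Arith

Num : Arith → Set
Num int = ℤ
Num rat = ℚ

0# 1# : ∀ κ → Num κ
0# int = + 0
0# rat = 0ℚ
1# int = + 1
1# rat = 1ℚ

add mul : ∀ κ → Num κ → Num κ → Num κ
add int = ℤ._+_
add rat = ℚ._+_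
mul int = ℤ._*_
mul rat = ℚ._*_

neg : ∀ κ → Num κ → Num κ
neg int = ℤ.-_
neg rat = ℚ.-_

Less Leq : ∀ κ → Num κ → Num κ → Set
Less int = ℤ._<_
Less rat = ℚ._<_
Leq int = ℤ._≤_
Leq rat = ℚ._≤_

Num⁺ : Arith → Set
Num⁺ κ = Σ[ c ∈ Num κ ] Less κ (0# κ) c

mul⁺ : ∀ κ → Num⁺ κ → Num⁺ κ → Num⁺ κ
mul⁺ int (+[1+ m ] , _) (+[1+ n ] , _) = +[1+ m ] ℤ.* +[1+ n ] , +<+ (s≤s z≤n)
mul⁺ int (+[1+ _ ] , _) (+ 0 , +<+ ())
mul⁺ int (+[1+ _ ] , _) (-[1+ _ ] , ())
mul⁺ int (+ 0 , +<+ ()) _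
mul⁺ int (-[1+ _ ] , ()) _
mul⁺ rat (p , 0<p) (q , 0<q) =
  p ℚ.* q , ℚ.positive⁻¹ _ {{ℚ.pos*pos⇒pos p {{ℚ.positive 0<p}} q {{ℚ.positive 0<q}}}}

-- v ≤ (q -ε)  means  v < q.
data ℚε : Set where
  ⌜_⌝ : ℚ → ℚε
  _-ε : ℚ → ℚε

Bound : Arith → Set
Bound int = ℤ
Bound rat = ℚε

0ᵇ : ∀ κ → Bound κ
0ᵇ int = + 0
0ᵇ rat = ⌜ 0ℚ ⌝

AtMost : ∀ κ → Num κ → Bound κ → Set
AtMost int v c = v ℤ.≤ c
AtMost rat v ⌜ q ⌝ = v ℚ.≤ q
AtMost rat v (q -ε) = v ℚ.< q

-- The bound c′ such that  s > c  is  - s ≤ c′.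
negBound : ∀ κ → Bound κ → Bound κ
negBound int c = ℤ.- c ℤ.- + 1
negBound rat ⌜ q ⌝ = (ℚ.- q) -ε
negBound rat (q -ε) = ⌜ ℚ.- q ⌝

data Sort : Set where
  arith : Arith → Sort
  unint : ℕ → Sort

data Ty : Set where
  prop : Ty
  val  : Sort → Ty

-- The non-theory symbols: a countable supply of functions (codomain val σ;
-- variables are the nullary ones) and predicates (codomain prop) of each rank.
record Symbol : Set where
  constructor symbol
  field
    name : ℕ
    dom  : List Sort
    cod  : Ty

open Symbol public

data Term : Ty → Set where
  app    : (f : ℕ) {dom : List Sort} {cod : Ty} → All (λ σ → Term (val σ)) dom → Term cod
  const  : ∀ κ → Num κ → Term (val (arith κ))
  lin    : ∀ {κ} → List (Num κ × Term (val (arith κ))) → Term (val (arith κ))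
  ⌊_/_⌋  : Term (val (arith int)) → (k : ℕ) → .{{ℕ.NonZero k}} → Term (val (arith int))

-- The linear combination q₁ t₁ + … + qₙ tₙ.
Lin : Arith → Set
Lin κ = List (Num κ × Term (val (arith κ)))

var : ∀ {τ} → ℕ → Term τ
var x = app x []

varSymbol : Arith → ℕ → Symbol
varSymbol κ x = symbol x [] (val (arith κ))

scale : ∀ κ → Num κ → Lin κ → Lin κ
scale κ q = map λ (r , t) → mul κ q r , t

negate : ∀ κ → Lin κ → Lin κ
negate κ = map λ (r , t) → neg κ r , t

infix 6 _≤ˡ_ _≐_ _≭_

data Literal : Set where
  _≤ˡ_     : ∀ {κ} → Lin κ → Bound κ → Literal
  _≐_ _≭_  : ∀ {σ} → Term (val σ) → Term (val σ) → Literal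
  atom natom : Term prop → Literal

~_ : Literal → Literal
~ (_≤ˡ_ {κ} s c) = negate κ s ≤ˡ negBound κ c
~ (t ≐ u)        = t ≭ u
~ (t ≭ u)        = t ≐ u
~ atom t         = natom t
~ natom t        = atom t

infixr 5 _∧ᶠ_
infixr 4 _∨ᶠ_

data Formula : Set where
  lit        : Literal → Formula
  ⊤ᶠ ⊥ᶠ      : Formula
  ¬ᶠ_        : Formula → Formula
  _∧ᶠ_ _∨ᶠ_  : Formula → Formula → Formula

_xorᶠ_ : Formula → Formula → Formula
φ xorᶠ ψ = (φ ∧ᶠ ¬ᶠ ψ) ∨ᶠ (¬ᶠ φ ∧ᶠ ψ)

⋀ ⋁ : List Formula → Formula
⋀ = foldr _∧ᶠ_ ⊤ᶠ
⋁ = foldr _∨ᶠ_ ⊥ᶠ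

-- A clause is the disjunction of its literals.
Clause : Set
Clause = List Literal

-- Decidable equality is automatic classically; here it makes every
-- quantifier-free formula have a definite truth value.
record Domain : Set₁ where
  field
    Carrier : ℕ → Set
    point   : ∀ u → Carrier u
    _≟_     : ∀ {u} → DecidableEquality (Carrier u)

module _ (𝒟 : Domain) where

  ⟦_⟧ˢ : Sort → Set
  ⟦ arith κ ⟧ˢ = Num κ
  ⟦ unint u ⟧ˢ = Domain.Carrier 𝒟 u

  ⟦_⟧ : Ty → Set
  ⟦ prop ⟧  = Bool
  ⟦ val σ ⟧ = ⟦ σ ⟧ˢ

  Interpretation : Set
  Interpretation = (f : Symbol) → All ⟦_⟧ˢ (dom f) → ⟦ cod f ⟧

module _ {𝒟 : Domain} (ℐ : Interpretation 𝒟) where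

  eval : ∀ {τ} → Term τ → ⟦_⟧ 𝒟 τ
  evalArgs : ∀ {σs} → All (λ σ → Term (val σ)) σs → All (⟦_⟧ˢ 𝒟) σs
  evalLin : ∀ {κ} → Lin κ → Num κ

  eval (app f {σs} {τ} ts) = ℐ (symbol f σs τ) (evalArgs ts)
  eval (const κ q)         = q
  eval (lin s)             = evalLin s
  eval ⌊ t / k ⌋           = eval t ℤ./ℕ k

  evalArgs []       = []
  evalArgs (t ∷ ts) = eval t ∷ evalArgs ts

  evalLin {κ} []            = 0# κ
  evalLin {κ} ((q , t) ∷ s) = add κ (mul κ q (eval t)) (evalLin s)

  holds : Literal → Set
  holds (_≤ˡ_ {κ} s c) = AtMost κ (evalLin s) c
  holds (t ≐ u)        = eval t ≡ eval u
  holds (t ≭ u)        = eval t ≢ eval u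
  holds (atom t)       = T (eval t)
  holds (natom t)      = ¬ T (eval t)

  satisfies : Formula → Set
  satisfies (lit ℓ)   = holds ℓ
  satisfies ⊤ᶠ        = ⊤
  satisfies ⊥ᶠ        = ⊥
  satisfies (¬ᶠ φ)    = ¬ satisfies φ
  satisfies (φ ∧ᶠ ψ)  = satisfies φ × satisfies ψ
  satisfies (φ ∨ᶠ ψ)  = satisfies φ ⊎ satisfies ψ

infix 3 _⊨_

_⊨_ : Formula → Formula → Set₁
φ ⊨ ψ = ∀ 𝒟 (ℐ : Interpretation 𝒟) → satisfies ℐ φ → satisfies ℐ ψ

symbols : ∀ {τ} → Term τ → List Symbol
symbolsArgs : ∀ {σs} → All (λ σ → Term (val σ)) σs → List Symbol
symbolsLin : ∀ {κ} → Lin κ → List Symbol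

symbols (app f {σs} {τ} ts) = symbol f σs τ ∷ symbolsArgs ts
symbols (const κ q)         = []
symbols (lin s)             = symbolsLin s
symbols ⌊ t / k ⌋           = symbols t

symbolsArgs []       = []
symbolsArgs (t ∷ ts) = symbols t ++ symbolsArgs ts

symbolsLin []            = []
symbolsLin ((q , t) ∷ s) = symbols t ++ symbolsLin s

symbolsLit : Literal → List Symbol
symbolsLit (s ≤ˡ c) = symbolsLin s
symbolsLit (t ≐ u)  = symbols t ++ symbols u
symbolsLit (t ≭ u)  = symbols t ++ symbols u
symbolsLit (atom t) = symbols t
symbolsLit (natom t) = symbols t

symb : Formula → List Symbol
symb (lit ℓ)   = symbolsLit ℓ
symb ⊤ᶠ        = []
symb ⊥ᶠ        = []
symb (¬ᶠ φ)    = symb φ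
symb (φ ∧ᶠ ψ)  = symb φ ++ symb ψ
symb (φ ∨ᶠ ψ)  = symb φ ++ symb ψ

_≟ᵃ_ : DecidableEquality Arith
int ≟ᵃ int = yes refl
int ≟ᵃ rat = no λ ()
rat ≟ᵃ int = no λ ()
rat ≟ᵃ rat = yes refl

_≟ˢ_ : DecidableEquality Sort
arith κ ≟ˢ arith κ′ with κ ≟ᵃ κ′
... | yes refl = yes refl
... | no  κ≢κ′ = no λ { refl → κ≢κ′ refl }
unint u ≟ˢ unint u′ with u ℕ.≟ u′
... | yes refl = yes refl
... | no  u≢u′ = no λ { refl → u≢u′ refl }
arith _ ≟ˢ unint _ = no λ ()
unint _ ≟ˢ arith _ = no λ ()

_≟ᵗ_ : DecidableEquality Ty
prop  ≟ᵗ prop  = yes refl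
prop  ≟ᵗ val _ = no λ ()
val _ ≟ᵗ prop  = no λ ()
val σ ≟ᵗ val τ with σ ≟ˢ τ
... | yes refl = yes refl
... | no  σ≢τ  = no λ { refl → σ≢τ refl }

infix 4 _≟_

_≟_ : DecidableEquality Symbol
symbol f σs τ ≟ symbol g σs′ τ′ with f ℕ.≟ g | ≡-dec _≟ˢ_ σs σs′ | τ ≟ᵗ τ′
... | yes refl | yes refl | yes refl = yes refl
... | no  f≢g  | _        | _        = no λ { refl → f≢g refl }
... | yes _    | no  σ≢σ′ | _        = no λ { refl → σ≢σ′ refl }
... | yes _    | yes _    | no τ≢τ′  = no λ { refl → τ≢τ′ refl }

open DecMembership _≟_ using (_∈?_)

module _ {κ : Arith} (x : ℕ) (u : Term (val (arith κ))) where

  replaceIf : ∀ {f σs τ} → Dec (symbol f σs τ ≡ varSymbol κ x) → Term τ → Term τ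
  replaceIf (yes refl) t = u
  replaceIf (no _)     t = t

  substTerm : ∀ {τ} → Term τ → Term τ
  substArgs : ∀ {σs} → All (λ σ → Term (val σ)) σs → All (λ σ → Term (val σ)) σs
  substLin  : ∀ {κ′} → Lin κ′ → Lin κ′

  substTerm (app f {σs} {τ} ts) = replaceIf (symbol f σs τ ≟ varSymbol κ x) (app f (substArgs ts))
  substTerm (const κ′ q) = const κ′ q
  substTerm (lin s)      = lin (substLin s)
  substTerm ⌊ t / k ⌋    = ⌊ substTerm t / k ⌋

  substArgs []       = []
  substArgs (t ∷ ts) = substTerm t ∷ substArgs ts

  substLin []            = []
  substLin ((q , t) ∷ s) = (q , substTerm t) ∷ substLin s

  substLit : Literal → Literal
  substLit (s ≤ˡ c)  = substLin s ≤ˡ c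
  substLit (t ≐ t′)  = substTerm t ≐ substTerm t′
  substLit (t ≭ t′)  = substTerm t ≭ substTerm t′
  substLit (atom t)  = atom (substTerm t)
  substLit (natom t) = natom (substTerm t)

  subst : Formula → Formula
  subst (lit ℓ)   = lit (substLit ℓ)
  subst ⊤ᶠ        = ⊤ᶠ
  subst ⊥ᶠ        = ⊥ᶠ
  subst (¬ᶠ φ)    = ¬ᶠ subst φ
  subst (φ ∧ᶠ ψ)  = subst φ ∧ᶠ subst ψ
  subst (φ ∨ᶠ ψ)  = subst φ ∨ᶠ subst ψ

infix 9 _[_≔_]

_[_≔_] : ∀ {κ} → Formula → ℕ → Term (val (arith κ)) → Formula
F [ x ≔ u ] = subst x u F

-- The linear term  d₁ y₁ + … + dₙ yₙ + rest  over the variables y₁, …, yₙ, with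
-- positive dᵢ.  A yᵢ may be repeated: its coefficient is the sum of its dᵢ.
record Lin⁺ (κ : Arith) : Set where
  constructor _⊕_
  field
    head : List (Num⁺ κ × ℕ)
    rest : Lin κ

  vars : List ℕ
  vars = map proj₂ head

  term : Lin κ
  term = map (λ ((d , _) , y) → d , var y) head ++ rest

open Lin⁺ public

infixr 6 _·_⊞_

_·_⊞_ : ∀ {κ} → Num⁺ κ → ℕ → Lin⁺ κ → Lin⁺ κ
c · x ⊞ s = ((c , x) ∷ head s) ⊕ rest s

-- The values 0 and -ε of k; -k is then 0 or ε, and  v < ε  means  v ≤ 0.
data RatOffset : Set where
  0ᵒ -εᵒ : RatOffset

Offset : Arith → Set
Offset int = ℤ
Offset rat = RatOffset

-- v < - k
BelowNeg : ∀ κ → Num κ → Offset κ → Set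
BelowNeg int v k   = v ℤ.< ℤ.- k
BelowNeg rat v 0ᵒ  = v ℚ.< 0ℚ
BelowNeg rat v -εᵒ = v ℚ.≤ 0ℚ

OffsetRange : ∀ κ → Offset κ → Set
OffsetRange int k = -[1+ 0 ] ℤ.≤ k
OffsetRange rat k = ⊤

-- LA(s(y⃗), k, F(y⃗)), where y⃗ is the vector of variables of the Lin⁺ s.
record Pattern : Set where
  constructor LA
  field
    {sort}  : Arith
    linear  : Lin⁺ sort
    offset  : Offset sort
    formula : Formula

-- Formulae in negation normal form with additional leaves from X, which
-- therefore occur only positively.
data NNF (X : Set) : Set where
  lit        : Literal → NNF X
  ⊤ⁿ ⊥ⁿ      : NNF X
  _∧ⁿ_ _∨ⁿ_  : NNF X → NNF X → NNF X
  leaf       : X → NNF X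

Interpolant : Set
Interpolant = NNF Pattern

-- F[·]; the hole is  leaf nothing  and may occur several times.
Context : Set
Context = NNF (Maybe Pattern)

_[_] : Context → Interpolant → Interpolant
lit ℓ           [ G ] = lit ℓ
⊤ⁿ              [ G ] = ⊤ⁿ
⊥ⁿ              [ G ] = ⊥ⁿ
(I ∧ⁿ J)        [ G ] = (I [ G ]) ∧ⁿ (J [ G ])
(I ∨ⁿ J)        [ G ] = (I [ G ]) ∨ⁿ (J [ G ])
leaf (just P)   [ G ] = leaf P
leaf nothing    [ G ] = G

leaves : ∀ {X} → NNF X → List X
leaves (lit ℓ)   = []
leaves ⊤ⁿ        = []
leaves ⊥ⁿ        = []
leaves (I ∧ⁿ J)  = leaves I ++ leaves J
leaves (I ∨ⁿ J)  = leaves I ++ leaves J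
leaves (leaf x)  = x ∷ []

literals : ∀ {X} → NNF X → List Literal
literals (lit ℓ)   = ℓ ∷ []
literals ⊤ⁿ        = []
literals ⊥ⁿ        = []
literals (I ∧ⁿ J)  = literals I ++ literals J
literals (I ∨ⁿ J)  = literals I ++ literals J
literals (leaf x)  = []

HoleOccurs : Context → Set
HoleOccurs I = nothing ∈ leaves I

-- An LA-pattern denotes its formula; s and k are only recorded.
⌊_⌋ : Interpolant → Formula
⌊ lit ℓ ⌋   = lit ℓ
⌊ ⊤ⁿ ⌋      = ⊤ᶠ
⌊ ⊥ⁿ ⌋      = ⊥ᶠ
⌊ I ∧ⁿ J ⌋  = ⌊ I ⌋ ∧ᶠ ⌊ J ⌋
⌊ I ∨ⁿ J ⌋  = ⌊ I ⌋ ∨ᶠ ⌊ J ⌋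
⌊ leaf P ⌋  = Pattern.formula P

-- The recorded term s is part of the expression LA(s, k, F).
symbPattern : Pattern → List Symbol
symbPattern (LA s k F) = symbolsLin (term s) ++ symb F

symbMaybe : Maybe Pattern → List Symbol
symbMaybe (just P) = symbPattern P
symbMaybe nothing  = []

symbInterpolant : Interpolant → List Symbol
symbInterpolant I = concatMap symbolsLit (literals I) ++ concatMap symbPattern (leaves I)

symbContext : Context → List Symbol
symbContext I = concatMap symbolsLit (literals I) ++ concatMap symbMaybe (leaves I)

Monotone : ∀ κ → List ℕ → Formula → Set₁
Monotone κ ys F = ∀ 𝒟 (ℐ ℐ′ : Interpretation 𝒟) →
  (∀ f → f ∉ map (varSymbol κ) ys → ∀ vs → ℐ f vs ≡ ℐ′ f vs) →
  (∀ y → y ∈ ys → Leq κ (eval ℐ′ {val (arith κ)} (var y)) (eval ℐ {val (arith κ)} (var y))) →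
  satisfies ℐ F → satisfies ℐ′ F

data Scheme : Set where
  Pudlák McMillan : Scheme

-- What an auxiliary variable belongs to: eqn a b is the x shared by a = b and
-- a ≠ b, flag a b the Boolean p_x of a ≠ b.  The literal s ≤ c and its negation
-- (- s ≤ …) have different keys.
data Aux : Set where
  ineq : ∀ {κ} → Lin κ → Bound κ → Aux
  eqn  : ∀ {σ} → Term (val σ) → Term (val σ) → Aux
  flag : ∀ {σ} → Term (val σ) → Term (val σ) → Aux

typeOf : Aux → Ty
typeOf (ineq {κ} _ _) = val (arith κ)
typeOf (eqn {σ} _ _)  = val σ
typeOf (flag _ _)     = prop

data Locality : Set where
  A-local B-local shared mixed : Locality

record Setting : Set₁ where
  field
    A B    : Formula
    unsat  : A ∧ᶠ B ⊨ ⊥ᶠ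
    scheme : Scheme
    auxName          : Aux → ℕ
    auxName-distinct : Injective _≡_ _≡_ auxName

  auxSymbol : Aux → Symbol
  auxSymbol k = symbol (auxName k) [] (typeOf k)

  field
    fresh : ∀ k → auxSymbol k ∉ symb A × auxSymbol k ∉ symb B

  IsALocal IsBLocal IsShared : Symbol → Set
  IsALocal f = f ∈ symb A × f ∉ symb B
  IsBLocal f = f ∈ symb B × f ∉ symb A
  IsShared f = f ∈ symb A × f ∈ symb B

  isALocal? : ∀ f → Dec (IsALocal f)
  isALocal? f = (f ∈? symb A) ×-dec ¬? (f ∈? symb B)

  isBLocal? : ∀ f → Dec (IsBLocal f)
  isBLocal? f = (f ∈? symb B) ×-dec ¬? (f ∈? symb A)

  -- Meaningful for symbols of symb(A) ∪ symb(B), where having no A-local and no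
  -- B-local symbol means having shared symbols only.
  locality : List Symbol → Locality
  locality fs with any? isALocal? fs | any? isBLocal? fs
  ... | yes _ | yes _ = mixed
  ... | yes _ | no _  = A-local
  ... | no _  | yes _ = B-local
  ... | no _  | no _  = shared

  -- For a mixed  t = u,  the A-local side followed by the B-local side.
  orient : ∀ {σ} → Term (val σ) → Term (val σ) → Term (val σ) × Term (val σ)
  orient t u with locality (symbols t)
  ... | A-local = t , u
  ... | _       = u , t

  hasALocal? : ∀ {κ} (m : Num κ × Term (val (arith κ))) → Dec _
  hasALocal? (_ , t) = any? isALocal? (symbols t)

  -- The summands a and b of a mixed  a + b ≤ c.
  A-part B-part : ∀ {κ} → Lin κ → Lin κ
  A-part = filter hasALocal?
  B-part = filter λ m → ¬? (hasALocal? m)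

  -- The mixed literals for which projections are defined.
  MixedShape : Literal → Set
  MixedShape (s ≤ˡ c) = All (λ (_ , t) → ∃[ x ] t ≡ var x) s
  MixedShape (t ≐ u)  = (locality (symbols t) ≡ A-local × locality (symbols u) ≡ B-local)
                      ⊎ (locality (symbols t) ≡ B-local × locality (symbols u) ≡ A-local)
  MixedShape (t ≭ u)  = MixedShape (t ≐ u)
  MixedShape (atom _)  = ⊥
  MixedShape (natom _)  = ⊥

  Mixed : Literal → Set
  Mixed ℓ = locality (symbolsLit ℓ) ≡ mixed

  -- With freshness for A and B, literals over symb(A) ∪ symb(B) contain no
  -- auxiliary variables.
  Projectable : Literal → Set
  Projectable ℓ = All (λ f → f ∈ symb A ⊎ f ∈ symb B) (symbolsLit ℓ) × (Mixed ℓ → MixedShape ℓ)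

  A-shared : Scheme → Literal → Formula
  A-shared Pudlák   ℓ = lit ℓ
  A-shared McMillan ℓ = ⊤ᶠ

  A-mixed B-mixed : Literal → Formula
  A-mixed (_≤ˡ_ {κ} s c) = lit ((A-part s ++ (1# κ , var (auxName (ineq s c))) ∷ []) ≤ˡ 0ᵇ κ)
  A-mixed (t ≐ u) = let a , b = orient t u in
    lit (a ≐ var (auxName (eqn a b)))
  A-mixed (t ≭ u) = let a , b = orient t u in
    lit (atom (var (auxName (flag a b)))) xorᶠ lit (a ≐ var (auxName (eqn a b)))
  A-mixed (atom _) = ⊤ᶠ
  A-mixed (natom _) = ⊤ᶠ

  B-mixed (_≤ˡ_ {κ} s c) = lit (((neg κ (1# κ) , var (auxName (ineq s c))) ∷ B-part s) ≤ˡ c)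
  B-mixed (t ≐ u) = let a , b = orient t u in
    lit (var (auxName (eqn a b)) ≐ b)
  B-mixed (t ≭ u) = let a , b = orient t u in
    (¬ᶠ lit (atom (var (auxName (flag a b))))) xorᶠ lit (var (auxName (eqn a b)) ≐ b)
  B-mixed (atom _) = ⊤ᶠ
  B-mixed (natom _) = ⊤ᶠ

  projectA projectB : Locality → Literal → Formula
  projectA A-local ℓ = lit ℓ
  projectA B-local ℓ = ⊤ᶠ
  projectA shared  ℓ = A-shared scheme ℓ
  projectA mixed   ℓ = A-mixed ℓ
  projectB A-local ℓ = ⊤ᶠ
  projectB B-local ℓ = lit ℓ
  projectB shared  ℓ = lit ℓ
  projectB mixed   ℓ = B-mixed ℓ

  _↓A _↓B : Literal → Formula
  ℓ ↓A = projectA (locality (symbolsLit ℓ)) ℓ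
  ℓ ↓B = projectB (locality (symbolsLit ℓ)) ℓ

  mixedAux : Literal → List Aux
  mixedAux (s ≤ˡ c) = ineq s c ∷ []
  mixedAux (t ≐ u)  = let a , b = orient t u in eqn a b ∷ []
  mixedAux (t ≭ u)  = let a , b = orient t u in eqn a b ∷ flag a b ∷ []
  mixedAux (atom _)  = []
  mixedAux (natom _)  = []

  introduced : Locality → Literal → List Aux
  introduced mixed ℓ = mixedAux ℓ
  introduced _     ℓ = []

  auxSymbols : Literal → List Symbol
  auxSymbols ℓ = map auxSymbol (introduced (locality (symbolsLit ℓ)) ℓ)

  record PartialInterpolant (C : Clause) (I : Interpolant) : Set₁ where
    field
      A⊨I : A ∧ᶠ ⋀ (map (λ ℓ → (~ ℓ) ↓A) C) ⊨ ⌊ I ⌋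
      B⊨¬I : B ∧ᶠ (⋀ (map (λ ℓ → (~ ℓ) ↓B) C) ∧ᶠ ⌊ I ⌋) ⊨ ⊥ᶠ
      vocabulary : ∀ f → f ∈ symbInterpolant I →
        IsShared f ⊎ f ∈ concatMap (λ ℓ → auxSymbols (~ ℓ)) C

  -- f is the auxiliary variable of a mixed inequality literal.
  IsIneqAux : Symbol → Set
  IsIneqAux f = ∃[ κ ] Σ[ s ∈ Lin κ ] Σ[ c ∈ Bound κ ] Mixed (s ≤ˡ c) × f ≡ auxSymbol (ineq s c)

  -- The conditions under which LA(s(y⃗), k, F(y⃗)) may be used.
  record WellFormed (P : Pattern) : Set₁ where
    open Pattern P
    ys : List Symbol
    ys = map (varSymbol sort) (vars linear)
    field
      vars-aux    : All IsIneqAux ys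
      only-vars   : ∀ f → IsIneqAux f → f ∈ symbPattern P → f ∈ ys
      rest-free   : ∀ f → f ∈ ys → f ∉ symbolsLin (rest linear)
      offset-range : OffsetRange sort offset
      monotone    : Monotone sort (vars linear) formula
      false-above : ∀ 𝒟 (ℐ : Interpretation 𝒟) →
        Less sort (0# sort) (evalLin ℐ (term linear)) → ¬ satisfies ℐ formula
      true-below  : ∀ 𝒟 (ℐ : Interpretation 𝒟) →
        BelowNeg sort (evalLin ℐ (term linear)) offset → satisfies ℐ formula

  -- LA-patterns are well formed, and auxiliary variables of mixed inequalities
  -- occur only inside them.
  record Patterned (I : Interpolant) : Set₁ where
    field
      well-formed : All WellFormed (leaves I)
      only-inside : ∀ f → IsIneqAux f → f ∉ concatMap symbolsLit (literals I)

scale⁺ : ∀ {κ} → Num⁺ κ → Lin⁺ κ → Lin⁺ κ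
scale⁺ {κ} c s = map (λ (d , y) → mul⁺ κ c d , y) (head s) ⊕ scale κ (proj₁ c) (rest s)

_⊞_ : ∀ {κ} → Lin⁺ κ → Lin⁺ κ → Lin⁺ κ
s ⊞ t = (head s ++ head t) ⊕ (rest s ++ rest t)

s₃ : ∀ {κ} (c₁ c₂ : Num⁺ κ) (s₁ s₂ : Lin⁺ κ) → Lin⁺ κ
s₃ c₁ c₂ s₁ s₂ = scale⁺ c₂ s₁ ⊞ scale⁺ c₁ s₂

k₃ : ∀ κ (c₁ c₂ : Num⁺ κ) (k₁ k₂ : Offset κ) → Offset κ
k₃ int (c₁ , _) (c₂ , _) k₁ k₂ = c₂ ℤ.* k₁ ℤ.+ c₁ ℤ.* k₂ ℤ.+ c₁ ℤ.* c₂
k₃ rat _ _ -εᵒ k₂ = k₂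
k₃ rat _ _ 0ᵒ  k₂ = 0ᵒ

floorDiv : Lin int → Num⁺ int → Term (val (arith int))
floorDiv s (+[1+ n ] , _) = ⌊ lin s / suc n ⌋
floorDiv s (+ 0 , +<+ ())
floorDiv s (-[1+ _ ] , ())

-- The ceiling of n / c, as a natural number (used for n ≥ 0).
ceilDiv : ℤ → Num⁺ int → ℕ
ceilDiv n (+[1+ m ] , _) = ℤ.∣ ℤ.- ((ℤ.- n) ℤ./ℕ suc m) ∣
ceilDiv n (+ 0 , +<+ ())
ceilDiv n (-[1+ _ ] , ())

reciprocal : Num⁺ rat → ℚ
reciprocal (c , 0<c) = (1/ c) {{ℚ.pos⇒nonZero c {{ℚ.positive 0<c}}}}

F₃ : ∀ κ (x₁ x₂ : ℕ) (c₁ c₂ : Num⁺ κ) (s₁ s₂ : Lin⁺ κ) (k₁ : Offset κ) (F₁ F₂ : Formula) → Formula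
F₃ int x₁ x₂ c₁ c₂ s₁ s₂ k₁ F₁ F₂ =
  ⋁ (map disjunct (upTo (suc (ceilDiv (k₁ ℤ.+ + 1) c₁))))
  where
  fl : Term (val (arith int))
  fl = floorDiv (negate int (term s₁)) c₁
  disjunct : ℕ → Formula
  disjunct i = F₁ [ x₁ ≔ lin ((+ 1 , fl) ∷ (-[1+ 0 ] , const int (+ i)) ∷ []) ]
            ∧ᶠ F₂ [ x₂ ≔ lin ((+ 1 , const int (+ i)) ∷ (-[1+ 0 ] , fl) ∷ []) ]
F₃ rat x₁ x₂ c₁ c₂ s₁ s₂ k₁ F₁ F₂ = byOffset k₁
  where
  quotient : Lin rat
  quotient = scale rat (reciprocal c₁) (term s₁)
  byOffset : RatOffset → Formula
  byOffset -εᵒ = F₂ [ x₂ ≔ lin quotient ]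
  byOffset 0ᵒ  = lit (term (s₃ c₁ c₂ s₁ s₂) ≤ˡ (0ℚ -ε))
              ∨ᶠ (F₁ [ x₁ ≔ lin (negate rat quotient) ] ∧ᶠ F₂ [ x₂ ≔ lin quotient ])

{-# OPTIONS --safe #-}
module Submission where

-- The resolvent pattern eliminates the two auxiliary variables of the pivot: F₃ is
-- equivalent to the existence of a number v such that F₁ holds for x₁ = v and F₂ holds
-- for x₂ = - v (F₃-sound and F₃-complete).
--
-- As a function of the value of x₁ alone, F₁ is downward closed, false where
-- c₁ x₁ + s₁ > 0 and true where c₁ x₁ + s₁ < - k₁; likewise for F₂ (the record Cut).  So F₁
-- is undetermined only on a short window ending at - s₁ / c₁.  Over the integers a witness
-- v has the form ⌊ - s₁ / c₁ ⌋ - i with i ≥ 0, and a witness beyond the last disjunct can be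
-- raised to the last disjunct: F₁ is true there because it is below the window, and F₂
-- because its argument has decreased.  Over the rationals the window is empty
-- (k₁ = -ε) or the single point - s₁ / c₁ (k₁ = 0); in the second case a witness strictly
-- below that point forces s₃ < 0, and conversely s₃ < 0 leaves an open interval of values at
-- which both formulae are true.
--
-- That F₃ is again a well-formed pattern follows from the equivalence.  A witness for large
-- values of the other variables is still a witness for smaller ones, so F₃ is monotone.  The
-- bounds on x₁ and x₂ = - v, multiplied by c₂ and c₁, add up to s₃ ≤ 0, so F₃ is false above.
-- If s₃ < - k₃, some v lies below both windows at once (cuts-meet), so F₃ is true below.
--
-- The interpolant property comes from extending a model by values for x₁ and x₂.  In a model
-- of A and the A-projections, x₁ = a and x₂ = - a satisfy the projections of the pivot and of
-- its negation, so both premise interpolants hold (Premise.implied), and a is a witness for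
-- F₃ wherever F₁ and F₂ were needed.  In a model of B, the B-projections and the resolvent
-- interpolant, a witness v satisfies v + b ≤ c or not; the values x₂ = - v and x₁ = v
-- respectively satisfy the B-projection of the corresponding literal, which contradicts
-- that premise (Premise.refuted).  If F₃ or the inner interpolant is false, its surrounding
-- context holds whatever is put in its place, so any value meeting the B-projection works.

open import Algebra.Bundles using (CommutativeRing)
open import Algebra.Structures using (IsCommutativeRing)
import Algebra.Properties.Ring as RingProperties
open import Data.Bool.Base using (T)
open import Data.Bool.Properties using (T?)
open import Data.Integer.Base as ℤ using (ℤ; +_; +[1+_]; -[1+_]; +<+; +≤+; -≤+)
import Data.Integer.DivMod as ℤ
import Data.Integer.Properties as ℤ
open import Data.Integer.Tactic.RingSolver using () renaming (solve-∀ to ℤ-solve-∀)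
open import Data.List.Base using (List; []; _∷_; _++_; map; filter; concatMap; upTo)
open import Data.List.Membership.Propositional using (_∈_; _∉_; find; lose)
open import Data.List.Membership.Propositional.Properties
  using (∈-++⁺ˡ; ∈-++⁺ʳ; ∈-++⁻; ∈-map⁺; ∈-map⁻; ∈-upTo⁺; ∈-concatMap⁺; ∈-concatMap⁻)
open import Data.List.Properties using (map-∘; map-++; ++-identityʳ)
open import Data.List.Relation.Binary.Subset.Propositional using (_⊆_)
open import Data.List.Relation.Binary.Subset.Propositional.Properties
  using (concatMap⁺; ++⁺; xs⊆xs++ys; xs⊆ys++xs)
open import Data.List.Relation.Unary.All as All using (All; []; _∷_)
open import Data.List.Relation.Unary.Any using (here; there)
open import Data.Maybe.Base using (Maybe; just; nothing)
open import Data.Nat.Base as ℕ using (ℕ; suc; s≤s)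
import Data.Nat.Properties as ℕ
open import Data.Product as Product using (∃-syntax; _×_; _,_; proj₁; proj₂)
open import Data.Rational.Base as ℚ using (ℚ; 0ℚ; 1ℚ)
import Data.Rational.Properties as ℚ
open import Data.Rational.Solver using (module +-*-Solver)
open import Data.Sum.Base as Sum using (_⊎_; inj₁; inj₂; [_,_]′)
open import Data.Unit.Base using (⊤; tt)
open import Function.Base using (id; _∘_)
open import Level using (0ℓ)
open import Relation.Binary.PropositionalEquality as ≡
  using (_≡_; _≢_; refl; sym; trans; cong; cong₂)
open import Relation.Nullary using (Dec; yes; no; ¬_; contradiction; ¬?; _×-dec_; _⊎-dec_)
open import Relation.Unary using (Pred; Decidable)
open import Defs
import Data.List.Membership.DecPropositional as DecMembership

open DecMembership _≟_ using (_∈?_)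
open +-*-Solver using (_:=_; _:+_; _:*_; _:-_; :-_) renaming (solve to ℚ-solve)

-- The ring structure common to both arithmetics

Num-isCommutativeRing : ∀ κ → IsCommutativeRing _≡_ (add κ) (mul κ) (neg κ) (0# κ) (1# κ)
Num-isCommutativeRing int = ℤ.+-*-isCommutativeRing
Num-isCommutativeRing rat = ℚ.+-*-isCommutativeRing

Num-commutativeRing : Arith → CommutativeRing 0ℓ 0ℓ
Num-commutativeRing κ = record { isCommutativeRing = Num-isCommutativeRing κ }

open module Ring {κ} = CommutativeRing (Num-commutativeRing κ)
  using (+-assoc; +-comm; +-identityˡ; +-identityʳ; *-assoc; *-identityˡ; zeroʳ; distribˡ; -‿inverseʳ)
open module RingLaws {κ} = RingProperties (CommutativeRing.ring (Num-commutativeRing κ))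
  using (-‿involutive; -‿+-comm; -0#≈0#; -‿distribˡ-*; -1*x≈-x)

-- The multipliers c₂ and c₁ cancel the opposite values v and - v of x₁ and x₂.
resolvent-identity : ∀ κ (c₁ c₂ v σ₁ σ₂ : Num κ) →
  add κ (mul κ c₂ (add κ (mul κ c₁ v) σ₁)) (mul κ c₁ (add κ (mul κ c₂ (neg κ v)) σ₂)) ≡
  add κ (mul κ c₂ σ₁) (mul κ c₁ σ₂)
resolvent-identity int = identity
  where
  identity : ∀ c₁ c₂ v σ₁ σ₂ →
    c₂ ℤ.* (c₁ ℤ.* v ℤ.+ σ₁) ℤ.+ c₁ ℤ.* (c₂ ℤ.* (ℤ.- v) ℤ.+ σ₂) ≡ c₂ ℤ.* σ₁ ℤ.+ c₁ ℤ.* σ₂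
  identity = ℤ-solve-∀
resolvent-identity rat = identity
  where
  identity : ∀ c₁ c₂ v σ₁ σ₂ →
    c₂ ℚ.* (c₁ ℚ.* v ℚ.+ σ₁) ℚ.+ c₁ ℚ.* (c₂ ℚ.* (ℚ.- v) ℚ.+ σ₂) ≡ c₂ ℚ.* σ₁ ℚ.+ c₁ ℚ.* σ₂
  identity = ℚ-solve 5 (λ c₁ c₂ v σ₁ σ₂ →
    (c₂ :* (c₁ :* v :+ σ₁) :+ c₁ :* (c₂ :* (:- v) :+ σ₂)) := (c₂ :* σ₁ :+ c₁ :* σ₂)) refl

-- Downward closed predicates with a bounded window of indeterminacy

-- What remains of an LA-pattern c x + s when everything except the value of x is fixed:
-- σ is the value of s, and P v is the truth of the formula at x = v.
record Cut (κ : Arith) (c : Num⁺ κ) (σ : Num κ) (k : Offset κ) (P : Num κ → Set) : Set where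
  field
    lower   : ∀ {v w} → Leq κ v w → P w → P v
    bounded : ∀ {v} → P v → Leq κ (add κ (mul κ (proj₁ c) v) σ) (0# κ)
    below   : ∀ {v} → BelowNeg κ (add κ (mul κ (proj₁ c) v) σ) k → P v

open Cut

combine-≤0 : ∀ κ (c₁ c₂ : Num⁺ κ) {e f} → Leq κ e (0# κ) → Leq κ f (0# κ) →
  Leq κ (add κ (mul κ (proj₁ c₂) e) (mul κ (proj₁ c₁) f)) (0# κ)
combine-≤0 int (c₁ , 0<c₁) (c₂ , 0<c₂) {e} {f} e≤0 f≤0 = begin
  c₂ ℤ.* e ℤ.+ c₁ ℤ.* f      ≤⟨ ℤ.+-mono-≤ (ℤ.*-monoˡ-≤-nonNeg c₂ {{ℤ.nonNegative (ℤ.<⇒≤ 0<c₂)}} e≤0)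
                                           (ℤ.*-monoˡ-≤-nonNeg c₁ {{ℤ.nonNegative (ℤ.<⇒≤ 0<c₁)}} f≤0) ⟩
  c₂ ℤ.* + 0 ℤ.+ c₁ ℤ.* + 0  ≡⟨ cong₂ ℤ._+_ (ℤ.*-zeroʳ c₂) (ℤ.*-zeroʳ c₁) ⟩
  + 0                        ∎
  where open ℤ.≤-Reasoning
combine-≤0 rat (c₁ , 0<c₁) (c₂ , 0<c₂) {e} {f} e≤0 f≤0 = begin
  c₂ ℚ.* e ℚ.+ c₁ ℚ.* f    ≤⟨ ℚ.+-mono-≤ (ℚ.*-monoˡ-≤-nonNeg c₂ {{ℚ.nonNegative (ℚ.<⇒≤ 0<c₂)}} e≤0)
                                         (ℚ.*-monoˡ-≤-nonNeg c₁ {{ℚ.nonNegative (ℚ.<⇒≤ 0<c₁)}} f≤0) ⟩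
  c₂ ℚ.* 0ℚ ℚ.+ c₁ ℚ.* 0ℚ  ≡⟨ cong₂ ℚ._+_ (ℚ.*-zeroʳ c₂) (ℚ.*-zeroʳ c₁) ⟩
  0ℚ                       ∎
  where open ℚ.≤-Reasoning

cuts-bound : ∀ {κ c₁ c₂ σ₁ σ₂ k₁ k₂ P₁ P₂} → Cut κ c₁ σ₁ k₁ P₁ → Cut κ c₂ σ₂ k₂ P₂ →
  ∀ {v} → P₁ v → P₂ (neg κ v) →
  Leq κ (add κ (mul κ (proj₁ c₂) σ₁) (mul κ (proj₁ c₁) σ₂)) (0# κ)
cuts-bound {κ} {c₁} {c₂} {σ₁} {σ₂} cut₁ cut₂ {v} p₁ p₂ =
  ≡.subst (λ e → Leq κ e (0# κ)) (resolvent-identity κ (proj₁ c₁) (proj₁ c₂) v σ₁ σ₂)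
    (combine-≤0 κ c₁ c₂ (bounded cut₁ p₁) (bounded cut₂ p₂))

-- Elimination over the integers

-- q = ⌊ n / c ⌋, in multiplied form.
record IsFloor (n : ℤ) (c : Num⁺ int) (q : ℤ) : Set where
  field
    lower-bound : proj₁ c ℤ.* q ℤ.≤ n
    upper-bound : n ℤ.< proj₁ c ℤ.* ℤ.suc q

open IsFloor

/ℕ-isFloor : ∀ n d (0<d : + 0 ℤ.< +[1+ d ]) → IsFloor n (+[1+ d ] , 0<d) (n ℤ./ℕ suc d)
/ℕ-isFloor n d _ = record
  { lower-bound = ≡.subst (ℤ._≤ n) (ℤ.*-comm _ +[1+ d ]) (ℤ.[n/ℕd]*d≤n n (suc d))
  ; upper-bound = ≡.subst (n ℤ.<_) (ℤ.*-comm (ℤ.suc (n ℤ./ℕ suc d)) +[1+ d ]) (ℤ.n<s[n/ℕd]*d n (suc d))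
  }

floor : ∀ n c → ∃[ q ] IsFloor n c q
floor n (+[1+ d ] , 0<d) = _ , /ℕ-isFloor n d 0<d
floor n (+ 0 , +<+ ())
floor n (-[1+ _ ] , ())

floorDiv-isFloor : ∀ {𝒟} (ℐ : Interpretation 𝒟) t c → IsFloor (evalLin ℐ t) c (eval ℐ (floorDiv t c))
floorDiv-isFloor ℐ t (+[1+ d ] , 0<d) = /ℕ-isFloor (evalLin ℐ t) d 0<d
floorDiv-isFloor ℐ t (+ 0 , +<+ ())
floorDiv-isFloor ℐ t (-[1+ _ ] , ())

i≤+∣i∣ : ∀ i → i ℤ.≤ + ℤ.∣ i ∣
i≤+∣i∣ (+ n)    = ℤ.≤-refl
i≤+∣i∣ -[1+ n ] = -≤+

-- The absolute value in ceilDiv can only increase the result, so this bound holds for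
-- negative n as well.
≤-ceilDiv : ∀ n c → n ℤ.≤ proj₁ c ℤ.* + ceilDiv n c
≤-ceilDiv n c@(+[1+ d ] , 0<d) = begin
  n                                  ≡⟨ ℤ.neg-involutive n ⟨
  ℤ.- (ℤ.- n)                        ≤⟨ ℤ.neg-mono-≤ (lower-bound (/ℕ-isFloor (ℤ.- n) d 0<d)) ⟩
  ℤ.- (+[1+ d ] ℤ.* q)               ≡⟨ ℤ.neg-distribʳ-* +[1+ d ] q ⟩
  +[1+ d ] ℤ.* (ℤ.- q)               ≤⟨ ℤ.*-monoˡ-≤-nonNeg +[1+ d ] (i≤+∣i∣ (ℤ.- q)) ⟩
  +[1+ d ] ℤ.* + ceilDiv n c         ∎
  where
  open ℤ.≤-Reasoning
  q = (ℤ.- n) ℤ./ℕ suc d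
≤-ceilDiv n (+ 0 , +<+ ())
≤-ceilDiv n (-[1+ _ ] , ())

-- Hence every such v is fl - i for a natural number i.
below-floor : ∀ c {σ fl v} → IsFloor (ℤ.- σ) c fl → proj₁ c ℤ.* v ℤ.+ σ ℤ.≤ + 0 → v ℤ.≤ fl
below-floor (c , 0<c) {σ} {fl} {v} isFloor bound =
  ≡.subst (v ℤ.≤_) (ℤ.pred-suc fl) (ℤ.i<j⇒i≤pred[j] (ℤ.*-cancelˡ-<-nonNeg c {{ℤ.nonNegative (ℤ.<⇒≤ 0<c)}} (begin-strict
    c ℤ.* v                ≡⟨ add-subtract c v σ ⟩
    (c ℤ.* v ℤ.+ σ) ℤ.- σ  ≤⟨ ℤ.+-monoˡ-≤ (ℤ.- σ) bound ⟩
    + 0 ℤ.- σ              ≡⟨ ℤ.+-identityˡ (ℤ.- σ) ⟩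
    ℤ.- σ                  <⟨ upper-bound isFloor ⟩
    c ℤ.* ℤ.suc fl         ∎)))
  where
  open ℤ.≤-Reasoning
  add-subtract : ∀ c v σ → c ℤ.* v ≡ (c ℤ.* v ℤ.+ σ) ℤ.- σ
  add-subtract = ℤ-solve-∀

sub-sub : ∀ i j → j ≡ i ℤ.- (i ℤ.- j)
sub-sub = ℤ-solve-∀

-- A witness v is fl - i with i = fl - v.  If i exceeds the number N of the last disjunct,
-- fl - N serves instead: c₁ (fl - N) + σ₁ ≤ - (k₁ + 1) makes P₁ true, and P₂ is downward
-- closed.
int-cuts⇒disjunct : ∀ {c₁ c₂ σ₁ σ₂ k₁ k₂ P₁ P₂ fl} →
  Cut int c₁ σ₁ k₁ P₁ → Cut int c₂ σ₂ k₂ P₂ → IsFloor (ℤ.- σ₁) c₁ fl →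
  ∀ {v} → P₁ v → P₂ (ℤ.- v) →
  ∃[ i ] i ℕ.≤ ceilDiv (k₁ ℤ.+ + 1) c₁ × P₁ (fl ℤ.- + i) × P₂ (ℤ.- (fl ℤ.- + i))
int-cuts⇒disjunct {c₁} {c₂} {σ₁} {σ₂} {k₁} {k₂} {P₁} {P₂} {fl} cut₁ cut₂ isFloor {v} p₁ p₂
  with ℤ.∣ fl ℤ.- v ∣ ℕ.≤? ceilDiv (k₁ ℤ.+ + 1) c₁
... | yes i≤N = _ , i≤N , ≡.subst P₁ v≡ p₁ , ≡.subst (λ w → P₂ (ℤ.- w)) v≡ p₂
  where
  open ≡.≡-Reasoning
  v≡ : v ≡ fl ℤ.- + ℤ.∣ fl ℤ.- v ∣
  v≡ = begin
    v                          ≡⟨ sub-sub fl v ⟩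
    fl ℤ.- (fl ℤ.- v)          ≡⟨ cong (λ i → fl ℤ.- i) (ℤ.0≤i⇒+∣i∣≡i
                                    (ℤ.i≤j⇒0≤j-i (below-floor c₁ isFloor (bounded cut₁ p₁)))) ⟨
    fl ℤ.- + ℤ.∣ fl ℤ.- v ∣    ∎
... | no i≰N = N , ℕ.≤-refl , below cut₁ deep , lower cut₂ (ℤ.neg-mono-≤ v≤) p₂
  where
  open ℤ.≤-Reasoning
  c = proj₁ c₁
  N = ceilDiv (k₁ ℤ.+ + 1) c₁
  N≤ : + N ℤ.≤ fl ℤ.- v
  N≤ = begin
    + N                 ≤⟨ +≤+ (ℕ.<⇒≤ (ℕ.≰⇒> i≰N)) ⟩
    + ℤ.∣ fl ℤ.- v ∣    ≡⟨ ℤ.0≤i⇒+∣i∣≡i (ℤ.i≤j⇒0≤j-i (below-floor c₁ isFloor (bounded cut₁ p₁))) ⟩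
    fl ℤ.- v            ∎
  v≤ : v ℤ.≤ fl ℤ.- + N
  v≤ = begin
    v                  ≡⟨ sub-sub fl v ⟩
    fl ℤ.- (fl ℤ.- v)  ≤⟨ ℤ.+-monoʳ-≤ fl (ℤ.neg-mono-≤ N≤) ⟩
    fl ℤ.- + N         ∎
  expand : ∀ c f n s → c ℤ.* (f ℤ.- n) ℤ.+ s ≡ c ℤ.* f ℤ.- c ℤ.* n ℤ.+ s
  expand = ℤ-solve-∀
  collapse : ∀ s k → ℤ.- s ℤ.- (k ℤ.+ + 1) ℤ.+ s ≡ ℤ.- k ℤ.- + 1
  collapse = ℤ-solve-∀
  deep : c ℤ.* (fl ℤ.- + N) ℤ.+ σ₁ ℤ.< ℤ.- k₁
  deep = begin-strict
    c ℤ.* (fl ℤ.- + N) ℤ.+ σ₁             ≡⟨ expand c fl (+ N) σ₁ ⟩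
    c ℤ.* fl ℤ.- c ℤ.* + N ℤ.+ σ₁         ≤⟨ ℤ.+-monoˡ-≤ σ₁ (ℤ.+-mono-≤ (lower-bound isFloor)
                                               (ℤ.neg-mono-≤ (≤-ceilDiv (k₁ ℤ.+ + 1) c₁))) ⟩
    ℤ.- σ₁ ℤ.- (k₁ ℤ.+ + 1) ℤ.+ σ₁        ≡⟨ collapse σ₁ k₁ ⟩
    ℤ.- k₁ ℤ.- + 1                        <⟨ i-1<i (ℤ.- k₁) ⟩
    ℤ.- k₁                                ∎
    where
    i-1<i : ∀ i → i ℤ.- + 1 ℤ.< i
    i-1<i i = ≡.subst (ℤ._< i) (ℤ.+-comm ℤ.-1ℤ i) (ℤ.i≤pred[j]⇒i<j ℤ.≤-refl)

-- The greatest v with c₁ v + σ₁ ≤ - k₁ - 1.  Maximality gives c₁ (v + 1) + σ₁ ≥ - k₁, which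
-- turns the bound on c₂ σ₁ + c₁ σ₂ into c₁ (- c₂ v + σ₂) < - c₁ k₂; the summand c₁ c₂ of k₃
-- pays for the step from v to v + 1.
int-gap : ∀ {c₁ c₂ σ₁ σ₂ k₁ k₂ P₁ P₂} →
  Cut int c₁ σ₁ k₁ P₁ → Cut int c₂ σ₂ k₂ P₂ →
  BelowNeg int (proj₁ c₂ ℤ.* σ₁ ℤ.+ proj₁ c₁ ℤ.* σ₂) (k₃ int c₁ c₂ k₁ k₂) →
  ∃[ v ] P₁ v × P₂ (ℤ.- v)
int-gap {c₁ , 0<c₁} {c₂ , 0<c₂} {σ₁} {σ₂} {k₁} {k₂} cut₁ cut₂ σ₃<
  with v , isFloor ← floor (ℤ.- σ₁ ℤ.- (k₁ ℤ.+ + 1)) (c₁ , 0<c₁) =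
  v , below cut₁ (begin-strict
        c₁ ℤ.* v ℤ.+ σ₁                 ≤⟨ ℤ.+-monoˡ-≤ σ₁ (lower-bound isFloor) ⟩
        ℤ.- σ₁ ℤ.- (k₁ ℤ.+ + 1) ℤ.+ σ₁  ≡⟨ collapse σ₁ k₁ ⟩
        ℤ.- + 1 ℤ.+ (ℤ.- k₁)            <⟨ ℤ.i≤pred[j]⇒i<j ℤ.≤-refl ⟩
        ℤ.- k₁                          ∎)
    , below cut₂ (ℤ.*-cancelˡ-<-nonNeg c₁ {{ℤ.nonNegative (ℤ.<⇒≤ 0<c₁)}} (begin-strict
        c₁ ℤ.* (c₂ ℤ.* (ℤ.- v) ℤ.+ σ₂)
          ≡⟨ expand c₁ c₂ v σ₂ ⟩
        c₂ ℤ.* (c₁ ℤ.- c₁ ℤ.* ℤ.suc v) ℤ.+ c₁ ℤ.* σ₂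
          ≤⟨ ℤ.+-monoˡ-≤ (c₁ ℤ.* σ₂) (ℤ.*-monoˡ-≤-nonNeg c₂ {{ℤ.nonNegative (ℤ.<⇒≤ 0<c₂)}}
               (ℤ.+-monoʳ-≤ c₁ (ℤ.neg-mono-≤ (ℤ.i<j⇒suc[i]≤j (upper-bound isFloor))))) ⟩
        c₂ ℤ.* (c₁ ℤ.- (+ 1 ℤ.+ (ℤ.- σ₁ ℤ.- (k₁ ℤ.+ + 1)))) ℤ.+ c₁ ℤ.* σ₂
          ≡⟨ regroup c₁ c₂ σ₁ σ₂ k₁ ⟩
        (c₂ ℤ.* σ₁ ℤ.+ c₁ ℤ.* σ₂) ℤ.+ (c₂ ℤ.* k₁ ℤ.+ c₁ ℤ.* c₂)
          <⟨ ℤ.+-monoˡ-< (c₂ ℤ.* k₁ ℤ.+ c₁ ℤ.* c₂) σ₃< ⟩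
        ℤ.- (c₂ ℤ.* k₁ ℤ.+ c₁ ℤ.* k₂ ℤ.+ c₁ ℤ.* c₂) ℤ.+ (c₂ ℤ.* k₁ ℤ.+ c₁ ℤ.* c₂)
          ≡⟨ cancel c₁ c₂ k₁ k₂ ⟩
        c₁ ℤ.* (ℤ.- k₂) ∎))
  where
  open ℤ.≤-Reasoning
  collapse : ∀ s k → ℤ.- s ℤ.- (k ℤ.+ + 1) ℤ.+ s ≡ ℤ.- + 1 ℤ.+ (ℤ.- k)
  collapse = ℤ-solve-∀
  expand : ∀ c₁ c₂ v s →
    c₁ ℤ.* (c₂ ℤ.* (ℤ.- v) ℤ.+ s) ≡ c₂ ℤ.* (c₁ ℤ.- c₁ ℤ.* (+ 1 ℤ.+ v)) ℤ.+ c₁ ℤ.* s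
  expand = ℤ-solve-∀
  regroup : ∀ c₁ c₂ s₁ s₂ k₁ →
    c₂ ℤ.* (c₁ ℤ.- (+ 1 ℤ.+ (ℤ.- s₁ ℤ.- (k₁ ℤ.+ + 1)))) ℤ.+ c₁ ℤ.* s₂ ≡
    (c₂ ℤ.* s₁ ℤ.+ c₁ ℤ.* s₂) ℤ.+ (c₂ ℤ.* k₁ ℤ.+ c₁ ℤ.* c₂)
  regroup = ℤ-solve-∀
  cancel : ∀ c₁ c₂ k₁ k₂ →
    ℤ.- (c₂ ℤ.* k₁ ℤ.+ c₁ ℤ.* k₂ ℤ.+ c₁ ℤ.* c₂) ℤ.+ (c₂ ℤ.* k₁ ℤ.+ c₁ ℤ.* c₂) ≡ c₁ ℤ.* (ℤ.- k₂)
  cancel = ℤ-solve-∀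

-- Elimination over the rationals

reciprocal-inverse : ∀ c q → proj₁ c ℚ.* (reciprocal c ℚ.* q) ≡ q
reciprocal-inverse (c , 0<c) q = begin
  c ℚ.* (r ℚ.* q)  ≡⟨ ℚ.*-assoc c r q ⟨
  c ℚ.* r ℚ.* q    ≡⟨ cong (ℚ._* q) (ℚ.*-inverseʳ c {{ℚ.pos⇒nonZero c {{ℚ.positive 0<c}}}}) ⟩
  1ℚ ℚ.* q         ≡⟨ ℚ.*-identityˡ q ⟩
  q                ∎
  where
  open ≡.≡-Reasoning
  r = reciprocal (c , 0<c)

bounded⇒quotient≤ : ∀ c {v σ} → proj₁ c ℚ.* v ℚ.+ σ ℚ.≤ 0ℚ → reciprocal c ℚ.* σ ℚ.≤ ℚ.- v
bounded⇒quotient≤ c⁺@(c , 0<c) {v} {σ} bound = ℚ.*-cancelˡ-≤-pos c {{ℚ.positive 0<c}} (begin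
  c ℚ.* (reciprocal c⁺ ℚ.* σ)        ≡⟨ reciprocal-inverse c⁺ σ ⟩
  σ                                  ≡⟨ regroup c v σ ⟩
  (c ℚ.* v ℚ.+ σ) ℚ.+ c ℚ.* (ℚ.- v)  ≤⟨ ℚ.+-monoˡ-≤ (c ℚ.* (ℚ.- v)) bound ⟩
  0ℚ ℚ.+ c ℚ.* (ℚ.- v)               ≡⟨ ℚ.+-identityˡ (c ℚ.* (ℚ.- v)) ⟩
  c ℚ.* (ℚ.- v)                      ∎)
  where
  open ℚ.≤-Reasoning
  regroup : ∀ c v σ → σ ≡ (c ℚ.* v ℚ.+ σ) ℚ.+ c ℚ.* (ℚ.- v)
  regroup = ℚ-solve 3 (λ c v σ →
    σ := ((c :* v :+ σ) :+ c :* (:- v))) refl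

*-pos-neg : ∀ (c : Num⁺ rat) {p} → p ℚ.< 0ℚ → proj₁ c ℚ.* p ℚ.< 0ℚ
*-pos-neg (c , 0<c) {p} p<0 =
  ≡.subst (c ℚ.* p ℚ.<_) (ℚ.*-zeroʳ c) (ℚ.*-monoʳ-<-pos c {{ℚ.positive 0<c}} p<0)

p<q⇒p-q<0 : ∀ {p q} → p ℚ.< q → p ℚ.- q ℚ.< 0ℚ
p<q⇒p-q<0 {p} {q} p<q = ≡.subst (p ℚ.- q ℚ.<_) (ℚ.+-inverseʳ q) (ℚ.+-monoˡ-< (ℚ.- q) p<q)

at-quotient : ∀ c σ → proj₁ c ℚ.* (ℚ.- (reciprocal c ℚ.* σ)) ℚ.+ σ ≡ 0ℚ
at-quotient c⁺@(c , _) σ = begin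
  c ℚ.* (ℚ.- q) ℚ.+ σ    ≡⟨ cong (ℚ._+ σ) (ℚ.neg-distribʳ-* c q) ⟨
  ℚ.- (c ℚ.* q) ℚ.+ σ    ≡⟨ cong (λ e → ℚ.- e ℚ.+ σ) (reciprocal-inverse c⁺ σ) ⟩
  ℚ.- σ ℚ.+ σ            ≡⟨ ℚ.+-inverseˡ σ ⟩
  0ℚ                     ∎
  where
  open ≡.≡-Reasoning
  q = reciprocal c⁺ ℚ.* σ

before-quotient : ∀ c {σ w} → reciprocal c ℚ.* σ ℚ.< w → proj₁ c ℚ.* (ℚ.- w) ℚ.+ σ ℚ.< 0ℚ
before-quotient c⁺@(c , _) {σ} {w} q<w = begin-strict
  c ℚ.* (ℚ.- w) ℚ.+ σ                      ≡⟨ regroup c w q σ ⟩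
  c ℚ.* (q ℚ.- w) ℚ.+ (c ℚ.* (ℚ.- q) ℚ.+ σ)  ≡⟨ cong (c ℚ.* (q ℚ.- w) ℚ.+_) (at-quotient c⁺ σ) ⟩
  c ℚ.* (q ℚ.- w) ℚ.+ 0ℚ                   ≡⟨ ℚ.+-identityʳ _ ⟩
  c ℚ.* (q ℚ.- w)                          <⟨ *-pos-neg c⁺ (p<q⇒p-q<0 q<w) ⟩
  0ℚ                                       ∎
  where
  open ℚ.≤-Reasoning
  q = reciprocal c⁺ ℚ.* σ
  regroup : ∀ c w q σ → c ℚ.* (ℚ.- w) ℚ.+ σ ≡ c ℚ.* (q ℚ.- w) ℚ.+ (c ℚ.* (ℚ.- q) ℚ.+ σ)
  regroup = ℚ-solve 4 (λ c w q σ →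
    (c :* (:- w) :+ σ) := (c :* (q :- w) :+ (c :* (:- q) :+ σ))) refl

rat-cuts⇒quotient : ∀ {c₁ c₂ σ₁ σ₂ k₁ k₂ P₁ P₂} →
  Cut rat c₁ σ₁ k₁ P₁ → Cut rat c₂ σ₂ k₂ P₂ →
  ∀ {v} → P₁ v → P₂ (ℚ.- v) → P₂ (reciprocal c₁ ℚ.* σ₁)
rat-cuts⇒quotient {c₁} cut₁ cut₂ p₁ p₂ = lower cut₂ (bounded⇒quotient≤ c₁ (bounded cut₁ p₁)) p₂

-- If - v lies at or below the quotient q, then P₁ holds at - q ≤ v.  Otherwise
-- c₁ v + σ₁ is strictly negative, and so is the combination of the two bounds.
rat-cuts⇒disjunct : ∀ {c₁ c₂ σ₁ σ₂ k₁ k₂ P₁ P₂} →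
  Cut rat c₁ σ₁ k₁ P₁ → Cut rat c₂ σ₂ k₂ P₂ →
  ∀ {v} → P₁ v → P₂ (ℚ.- v) →
  proj₁ c₂ ℚ.* σ₁ ℚ.+ proj₁ c₁ ℚ.* σ₂ ℚ.< 0ℚ ⊎ P₁ (ℚ.- (reciprocal c₁ ℚ.* σ₁))
rat-cuts⇒disjunct {c₁} {c₂} {σ₁} {σ₂} {P₁ = P₁} cut₁ cut₂ {v} p₁ p₂
  with ℚ.- v ℚ.≤? reciprocal c₁ ℚ.* σ₁
... | yes -v≤q = inj₂ (lower cut₁ (≡.subst (ℚ.- (reciprocal c₁ ℚ.* σ₁) ℚ.≤_) (-‿involutive {rat} v)
                                      (ℚ.neg-antimono-≤ -v≤q)) p₁)
... | no -v≰q = inj₁ (≡.subst (ℚ._< 0ℚ)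
    (resolvent-identity rat (proj₁ c₁) (proj₁ c₂) v σ₁ σ₂)
    (ℚ.+-mono-<-≤ (*-pos-neg c₂ strict) (≡.subst (proj₁ c₁ ℚ.* _ ℚ.≤_) (ℚ.*-zeroʳ (proj₁ c₁))
      (ℚ.*-monoˡ-≤-nonNeg (proj₁ c₁) {{ℚ.nonNegative (ℚ.<⇒≤ (proj₂ c₁))}} (bounded cut₂ p₂)))))
  where
  strict : proj₁ c₁ ℚ.* v ℚ.+ σ₁ ℚ.< 0ℚ
  strict = ≡.subst (λ w → proj₁ c₁ ℚ.* w ℚ.+ σ₁ ℚ.< 0ℚ) (-‿involutive {rat} v)
    (before-quotient c₁ (ℚ.≰⇒> -v≰q))

BelowNeg-strict : ∀ k {v} → v ℚ.< 0ℚ → BelowNeg rat v k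
BelowNeg-strict 0ᵒ  v<0 = v<0
BelowNeg-strict -εᵒ v<0 = ℚ.<⇒≤ v<0

-- Stated for the quotients q₁ = σ₁ / c₁ and q₂ = σ₂ / c₂ themselves: the hypothesis is then
-- c₂ σ₁ + c₁ σ₂ < 0.
quotients-apart : ∀ (c₁ c₂ : Num⁺ rat) q₁ q₂ →
  proj₁ c₂ ℚ.* (proj₁ c₁ ℚ.* q₁) ℚ.+ proj₁ c₁ ℚ.* (proj₁ c₂ ℚ.* q₂) ℚ.< 0ℚ → q₁ ℚ.< ℚ.- q₂
quotients-apart (c₁ , 0<c₁) (c₂ , 0<c₂) q₁ q₂ sum<0 =
  ℚ.*-cancelˡ-<-nonNeg c₂ {{ℚ.nonNegative (ℚ.<⇒≤ 0<c₂)}} {q₁} {ℚ.- q₂}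
    (ℚ.*-cancelˡ-<-nonNeg c₁ {{ℚ.nonNegative (ℚ.<⇒≤ 0<c₁)}} {c₂ ℚ.* q₁} {c₂ ℚ.* (ℚ.- q₂)} (begin-strict
      c₁ ℚ.* (c₂ ℚ.* q₁)
        ≡⟨ regroup c₁ c₂ q₁ q₂ ⟩
      (c₂ ℚ.* (c₁ ℚ.* q₁) ℚ.+ c₁ ℚ.* (c₂ ℚ.* q₂)) ℚ.+ c₁ ℚ.* (c₂ ℚ.* (ℚ.- q₂))
        <⟨ ℚ.+-monoˡ-< (c₁ ℚ.* (c₂ ℚ.* (ℚ.- q₂))) sum<0 ⟩
      0ℚ ℚ.+ c₁ ℚ.* (c₂ ℚ.* (ℚ.- q₂))
        ≡⟨ ℚ.+-identityˡ (c₁ ℚ.* (c₂ ℚ.* (ℚ.- q₂))) ⟩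
      c₁ ℚ.* (c₂ ℚ.* (ℚ.- q₂)) ∎))
  where
  open ℚ.≤-Reasoning
  regroup : ∀ c₁ c₂ q₁ q₂ →
    c₁ ℚ.* (c₂ ℚ.* q₁) ≡ (c₂ ℚ.* (c₁ ℚ.* q₁) ℚ.+ c₁ ℚ.* (c₂ ℚ.* q₂)) ℚ.+ c₁ ℚ.* (c₂ ℚ.* (ℚ.- q₂))
  regroup = ℚ-solve 4 (λ c₁ c₂ q₁ q₂ →
    (c₁ :* (c₂ :* q₁)) := ((c₂ :* (c₁ :* q₁) :+ c₁ :* (c₂ :* q₂)) :+ c₁ :* (c₂ :* (:- q₂)))) refl

-- Any w strictly between σ₁ / c₁ and - σ₂ / c₂ gives strict negativity on both sides, which
-- lies below the window for either value of the offset.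
rat-gap : ∀ {c₁ c₂ σ₁ σ₂ k₁ k₂ P₁ P₂} →
  Cut rat c₁ σ₁ k₁ P₁ → Cut rat c₂ σ₂ k₂ P₂ →
  proj₁ c₂ ℚ.* σ₁ ℚ.+ proj₁ c₁ ℚ.* σ₂ ℚ.< 0ℚ →
  ∃[ v ] P₁ v × P₂ (ℚ.- v)
rat-gap {c₁} {c₂} {σ₁} {σ₂} {k₁} {k₂} {P₂ = P₂} cut₁ cut₂ σ₃<0 =
  let w , q₁<w , w<-q₂ = ℚ.<-dense (quotients-apart c₁ c₂ (reciprocal c₁ ℚ.* σ₁) (reciprocal c₂ ℚ.* σ₂)
         (≡.subst (ℚ._< 0ℚ) (cong₂ (λ e f → proj₁ c₂ ℚ.* e ℚ.+ proj₁ c₁ ℚ.* f)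
           (sym (reciprocal-inverse c₁ σ₁)) (sym (reciprocal-inverse c₂ σ₂))) σ₃<0)) in
  ℚ.- w , below cut₁ (BelowNeg-strict k₁ (before-quotient c₁ q₁<w))
        , below cut₂ (BelowNeg-strict k₂ (before-quotient c₂
            (≡.subst (ℚ._< ℚ.- w) (-‿involutive {rat} (reciprocal c₂ ℚ.* σ₂)) (ℚ.neg-antimono-< w<-q₂))))

-- For k₁ = -ε the predicate P₁ is already true at the end point, where c₁ v + σ₁ = 0.
rat-quotient⇒cuts : ∀ {c₁ c₂ σ₁ σ₂ k₂ P₁ P₂} →
  Cut rat c₁ σ₁ -εᵒ P₁ → Cut rat c₂ σ₂ k₂ P₂ → P₂ (reciprocal c₁ ℚ.* σ₁) →
  ∃[ v ] P₁ v × P₂ (ℚ.- v)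
rat-quotient⇒cuts {c₁} {σ₁ = σ₁} {P₂ = P₂} cut₁ cut₂ p₂ =
  ℚ.- q , below cut₁ (ℚ.≤-reflexive (at-quotient c₁ σ₁)) , ≡.subst P₂ (sym (-‿involutive {rat} q)) p₂
  where q = reciprocal c₁ ℚ.* σ₁

-- The offset of the resolvent

BelowNeg-unscale : ∀ (c : Num⁺ rat) k {e} → BelowNeg rat (proj₁ c ℚ.* e) k → BelowNeg rat e k
BelowNeg-unscale (c , 0<c) 0ᵒ  {e} ce<0 = ℚ.*-cancelˡ-<-nonNeg c {{ℚ.nonNegative (ℚ.<⇒≤ 0<c)}} {e} {0ℚ}
  (≡.subst (c ℚ.* e ℚ.<_) (sym (ℚ.*-zeroʳ c)) ce<0)
BelowNeg-unscale (c , 0<c) -εᵒ {e} ce≤0 = ℚ.*-cancelˡ-≤-pos c {{ℚ.positive 0<c}}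
  (≡.subst (c ℚ.* e ℚ.≤_) (sym (ℚ.*-zeroʳ c)) ce≤0)

-- For a rational k₁ = -ε the witness is the end point of the first cut: there
-- c₁ (- c₂ v + σ₂) = c₂ σ₁ + c₁ σ₂, so the second value is below its window.
cuts-meet : ∀ κ {c₁ c₂ : Num⁺ κ} {σ₁ σ₂ k₁ k₂ P₁ P₂} → Cut κ c₁ σ₁ k₁ P₁ → Cut κ c₂ σ₂ k₂ P₂ →
  BelowNeg κ (add κ (mul κ (proj₁ c₂) σ₁) (mul κ (proj₁ c₁) σ₂)) (k₃ κ c₁ c₂ k₁ k₂) →
  ∃[ v ] P₁ v × P₂ (neg κ v)
cuts-meet int = int-gap
cuts-meet rat {k₁ = 0ᵒ} = rat-gap
cuts-meet rat {c₁⁺@(c₁ , _)} {c₂⁺@(c₂ , _)} {σ₁} {σ₂} { -εᵒ} {k₂} cut₁ cut₂ σ₃< =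
  rat-quotient⇒cuts cut₁ cut₂ (below cut₂ (BelowNeg-unscale c₁⁺ k₂
    (≡.subst (λ σ → BelowNeg rat σ k₂) σ₃≡ σ₃<)))
  where
  open ≡.≡-Reasoning
  q = reciprocal c₁⁺ ℚ.* σ₁
  regroup : ∀ c₁ c₂ q σ₂ → c₂ ℚ.* (c₁ ℚ.* q) ℚ.+ c₁ ℚ.* σ₂ ≡ c₁ ℚ.* (c₂ ℚ.* q ℚ.+ σ₂)
  regroup = ℚ-solve 4 (λ c₁ c₂ q σ₂ →
    (c₂ :* (c₁ :* q) :+ c₁ :* σ₂) := (c₁ :* (c₂ :* q :+ σ₂))) refl
  σ₃≡ : c₂ ℚ.* σ₁ ℚ.+ c₁ ℚ.* σ₂ ≡ c₁ ℚ.* (c₂ ℚ.* q ℚ.+ σ₂)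
  σ₃≡ = begin
    c₂ ℚ.* σ₁ ℚ.+ c₁ ℚ.* σ₂           ≡⟨ cong (λ e → c₂ ℚ.* e ℚ.+ c₁ ℚ.* σ₂) (reciprocal-inverse c₁⁺ σ₁) ⟨
    c₂ ℚ.* (c₁ ℚ.* q) ℚ.+ c₁ ℚ.* σ₂   ≡⟨ regroup c₁ c₂ q σ₂ ⟩
    c₁ ℚ.* (c₂ ℚ.* q ℚ.+ σ₂)          ∎

-- k₃ + 1 = c₂ (k₁ + 1) + c₁ (k₂ + 1) + (c₁ - 1) (c₂ - 1).
k₃-range : ∀ κ (c₁ c₂ : Num⁺ κ) {k₁ k₂} → OffsetRange κ k₁ → OffsetRange κ k₂ →
  OffsetRange κ (k₃ κ c₁ c₂ k₁ k₂)
k₃-range rat _ _ _ _ = _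
k₃-range int (c₁ , 0<c₁) (c₂ , 0<c₂) {k₁} {k₂} -1≤k₁ -1≤k₂ = begin
  ℤ.-1ℤ
    ≤⟨ ℤ.+-monoˡ-≤ ℤ.-1ℤ (ℤ.+-mono-≤ (ℤ.+-mono-≤
         (product (ℤ.<⇒≤ 0<c₂) (ℤ.i≤j⇒0≤j-i -1≤k₁)) (product (ℤ.<⇒≤ 0<c₁) (ℤ.i≤j⇒0≤j-i -1≤k₂)))
         (product (ℤ.i≤j⇒0≤j-i (ℤ.i<j⇒suc[i]≤j 0<c₁)) (ℤ.i≤j⇒0≤j-i (ℤ.i<j⇒suc[i]≤j 0<c₂)))) ⟩
  c₂ ℤ.* (k₁ ℤ.+ + 1) ℤ.+ c₁ ℤ.* (k₂ ℤ.+ + 1) ℤ.+ (c₁ ℤ.- + 1) ℤ.* (c₂ ℤ.- + 1) ℤ.+ ℤ.- + 1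
    ≡⟨ regroup c₁ c₂ k₁ k₂ ⟩
  c₂ ℤ.* k₁ ℤ.+ c₁ ℤ.* k₂ ℤ.+ c₁ ℤ.* c₂ ∎
  where
  open ℤ.≤-Reasoning
  product : ∀ {i j} → + 0 ℤ.≤ i → + 0 ℤ.≤ j → + 0 ℤ.≤ i ℤ.* j
  product {i} {j} 0≤i 0≤j = ≡.subst (ℤ._≤ i ℤ.* j) (ℤ.*-zeroʳ i)
    (ℤ.*-monoˡ-≤-nonNeg i {{ℤ.nonNegative 0≤i}} 0≤j)
  regroup : ∀ c₁ c₂ k₁ k₂ →
    c₂ ℤ.* (k₁ ℤ.+ + 1) ℤ.+ c₁ ℤ.* (k₂ ℤ.+ + 1) ℤ.+ (c₁ ℤ.- + 1) ℤ.* (c₂ ℤ.- + 1) ℤ.+ ℤ.- + 1 ≡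
    c₂ ℤ.* k₁ ℤ.+ c₁ ℤ.* k₂ ℤ.+ c₁ ℤ.* c₂
  regroup = ℤ-solve-∀

-- Values of linear terms

evalLin-++ : ∀ {𝒟 κ} (ℐ : Interpretation 𝒟) (s t : Lin κ) →
  evalLin ℐ (s ++ t) ≡ add κ (evalLin ℐ s) (evalLin ℐ t)
evalLin-++ ℐ []            t = sym (+-identityˡ _)
evalLin-++ ℐ ((q , u) ∷ s) t = trans (cong (add _ _) (evalLin-++ ℐ s t)) (sym (+-assoc _ _ _))

evalLin-scale : ∀ {𝒟 κ} (ℐ : Interpretation 𝒟) q (s : Lin κ) →
  evalLin ℐ (scale κ q s) ≡ mul κ q (evalLin ℐ s)
evalLin-scale ℐ q []            = sym (zeroʳ q)
evalLin-scale ℐ q ((r , t) ∷ s) =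
  trans (cong₂ (add _) (*-assoc q r (eval ℐ t)) (evalLin-scale ℐ q s)) (sym (distribˡ q _ _))

evalLin-negate : ∀ {𝒟 κ} (ℐ : Interpretation 𝒟) (s : Lin κ) →
  evalLin ℐ (negate κ s) ≡ neg κ (evalLin ℐ s)
evalLin-negate ℐ []            = sym -0#≈0#
evalLin-negate ℐ ((r , t) ∷ s) =
  trans (cong₂ (add _) (sym (-‿distribˡ-* r (eval ℐ t))) (evalLin-negate ℐ s)) (-‿+-comm _ _)

-- The two variable parts come before the two remainders, so the remainder of s has to move
-- past the variables of t.
term-⊞ : ∀ {𝒟 κ} (ℐ : Interpretation 𝒟) (s t : Lin⁺ κ) →
  evalLin ℐ (term (s ⊞ t)) ≡ add κ (evalLin ℐ (term s)) (evalLin ℐ (term t))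
term-⊞ {κ = κ} ℐ ([] ⊕ r) t = move (head t)
  where
  swap : ∀ (x y z : Num κ) → add κ x (add κ y z) ≡ add κ y (add κ x z)
  swap x y z = trans (sym (+-assoc x y z)) (trans (cong (λ w → add κ w z) (+-comm x y)) (+-assoc y x z))
  move : ∀ h → evalLin ℐ (term (h ⊕ (r ++ rest t))) ≡ add κ (evalLin ℐ r) (evalLin ℐ (term (h ⊕ rest t)))
  move []      = evalLin-++ ℐ r (rest t)
  move (m ∷ h) = trans (cong (add κ _) (move h)) (swap _ _ _)
term-⊞ ℐ ((_ ∷ h) ⊕ r) t = trans (cong (add _ _) (term-⊞ ℐ (h ⊕ r) t)) (sym (+-assoc _ _ _))

mul⁺-value : ∀ κ c d → proj₁ (mul⁺ κ c d) ≡ mul κ (proj₁ c) (proj₁ d)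
mul⁺-value rat (c , _) (d , _) = refl
mul⁺-value int (+[1+ m ] , _) (+[1+ n ] , _) = refl
mul⁺-value int (+[1+ _ ] , _) (+ 0 , +<+ ())
mul⁺-value int (+[1+ _ ] , _) (-[1+ _ ] , ())
mul⁺-value int (+ 0 , +<+ ()) _
mul⁺-value int (-[1+ _ ] , ()) _

term-scale⁺ : ∀ {κ} c (s : Lin⁺ κ) → term (scale⁺ c s) ≡ scale κ (proj₁ c) (term s)
term-scale⁺ c ([] ⊕ r)            = refl
term-scale⁺ c (((d , y) ∷ h) ⊕ r) =
  cong₂ _∷_ (cong (_, var y) (mul⁺-value _ c d)) (term-scale⁺ c (h ⊕ r))

evalLin-s₃ : ∀ {𝒟 κ} (ℐ : Interpretation 𝒟) (c₁ c₂ : Num⁺ κ) s₁ s₂ →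
  evalLin ℐ (term (s₃ c₁ c₂ s₁ s₂)) ≡
  add κ (mul κ (proj₁ c₂) (evalLin ℐ (term s₁))) (mul κ (proj₁ c₁) (evalLin ℐ (term s₂)))
evalLin-s₃ {κ = κ} ℐ c₁ c₂ s₁ s₂ =
  trans (term-⊞ ℐ (scale⁺ c₂ s₁) (scale⁺ c₁ s₂)) (cong₂ (add κ) (scaled c₂ s₁) (scaled c₁ s₂))
  where
  scaled : ∀ c s → evalLin ℐ (term (scale⁺ c s)) ≡ mul κ (proj₁ c) (evalLin ℐ (term s))
  scaled c s = trans (cong (evalLin ℐ) (term-scale⁺ c s)) (evalLin-scale ℐ (proj₁ c) (term s))

-- Negation of literals

negate-involutive : ∀ {κ} (s : Lin κ) → negate κ (negate κ s) ≡ s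
negate-involutive []            = refl
negate-involutive ((q , t) ∷ s) = cong₂ _∷_ (cong (_, t) (-‿involutive q)) (negate-involutive s)

negBound-involutive : ∀ κ c → negBound κ (negBound κ c) ≡ c
negBound-involutive int c = involutive c
  where
  involutive : ∀ c → ℤ.- (ℤ.- c ℤ.- + 1) ℤ.- + 1 ≡ c
  involutive = ℤ-solve-∀
negBound-involutive rat ⌜ q ⌝  = cong ⌜_⌝ (-‿involutive {rat} q)
negBound-involutive rat (q -ε) = cong _-ε (-‿involutive {rat} q)

~-involutive : ∀ ℓ → ~ ~ ℓ ≡ ℓ
~-involutive (s ≤ˡ c) = cong₂ _≤ˡ_ (negate-involutive s) (negBound-involutive _ c)
~-involutive (t ≐ u)  = refl
~-involutive (t ≭ u)  = refl
~-involutive (atom t)  = refl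
~-involutive (natom t) = refl

~-injective : ∀ {ℓ m} → ~ ℓ ≡ ~ m → ℓ ≡ m
~-injective {ℓ} {m} ~ℓ≡~m = trans (sym (~-involutive ℓ)) (trans (cong ~_ ~ℓ≡~m) (~-involutive m))

symbolsLin-negate : ∀ {κ} (s : Lin κ) → symbolsLin (negate κ s) ≡ symbolsLin s
symbolsLin-negate []            = refl
symbolsLin-negate ((q , t) ∷ s) = cong (symbols t ++_) (symbolsLin-negate s)

symbolsLit-~ : ∀ ℓ → symbolsLit (~ ℓ) ≡ symbolsLit ℓ
symbolsLit-~ (s ≤ˡ c)  = symbolsLin-negate s
symbolsLit-~ (t ≐ u)   = refl
symbolsLit-~ (t ≭ u)   = refl
symbolsLit-~ (atom t)  = refl
symbolsLit-~ (natom t) = refl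

-- Symbols of linear terms

symbolsLin-++⁻ : ∀ {κ} (s t : Lin κ) {f} → f ∈ symbolsLin (s ++ t) → f ∈ symbolsLin s ⊎ f ∈ symbolsLin t
symbolsLin-++⁻ []            t f∈ = inj₂ f∈
symbolsLin-++⁻ ((q , u) ∷ s) t f∈ with ∈-++⁻ (symbols u) f∈
... | inj₁ f∈u = inj₁ (∈-++⁺ˡ f∈u)
... | inj₂ f∈  = Sum.map₁ (∈-++⁺ʳ (symbols u)) (symbolsLin-++⁻ s t f∈)

symbolsLin-scale : ∀ {κ} q (s : Lin κ) → symbolsLin (scale κ q s) ≡ symbolsLin s
symbolsLin-scale q []            = refl
symbolsLin-scale q ((r , t) ∷ s) = cong (symbols t ++_) (symbolsLin-scale q s)

symbols-term⁻ : ∀ {κ} (s : Lin⁺ κ) {f} → f ∈ symbolsLin (term s) →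
  f ∈ map (varSymbol κ) (vars s) ⊎ f ∈ symbolsLin (rest s)
symbols-term⁻ ([] ⊕ r)      f∈         = inj₂ f∈
symbols-term⁻ ((_ ∷ h) ⊕ r) (here f≡)  = inj₁ (here f≡)
symbols-term⁻ ((_ ∷ h) ⊕ r) (there f∈) = Sum.map₁ there (symbols-term⁻ (h ⊕ r) f∈)

symbols-vars⁺ : ∀ {κ} (s : Lin⁺ κ) {f} → f ∈ map (varSymbol κ) (vars s) → f ∈ symbolsLin (term s)
symbols-vars⁺ ((_ ∷ h) ⊕ r) (here f≡)  = here f≡
symbols-vars⁺ ((_ ∷ h) ⊕ r) (there f∈) = there (symbols-vars⁺ (h ⊕ r) f∈)

symbols-rest⁺ : ∀ {κ} (s : Lin⁺ κ) {f} → f ∈ symbolsLin (rest s) → f ∈ symbolsLin (term s)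
symbols-rest⁺ ([] ⊕ r)      f∈ = f∈
symbols-rest⁺ ((_ ∷ h) ⊕ r) f∈ = there (symbols-rest⁺ (h ⊕ r) f∈)

vars-s₃ : ∀ {κ} (c₁ c₂ : Num⁺ κ) s₁ s₂ →
  map (varSymbol κ) (vars (s₃ c₁ c₂ s₁ s₂)) ≡ map (varSymbol κ) (vars s₁) ++ map (varSymbol κ) (vars s₂)
vars-s₃ {κ} c₁ c₂ s₁ s₂ = trans (cong (map (varSymbol κ)) (trans
  (map-++ proj₂ (head (scale⁺ c₂ s₁)) (head (scale⁺ c₁ s₂)))
  (cong₂ _++_ (sym (map-∘ (head s₁))) (sym (map-∘ (head s₂))))))
  (map-++ (varSymbol κ) (vars s₁) (vars s₂))

rest-s₃⁻ : ∀ {κ} (c₁ c₂ : Num⁺ κ) s₁ s₂ {f} → f ∈ symbolsLin (rest (s₃ c₁ c₂ s₁ s₂)) →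
  f ∈ symbolsLin (rest s₁) ⊎ f ∈ symbolsLin (rest s₂)
rest-s₃⁻ {κ} c₁ c₂ s₁ s₂ {f} f∈ = Sum.map
  (≡.subst (f ∈_) (symbolsLin-scale (proj₁ c₂) (rest s₁)))
  (≡.subst (f ∈_) (symbolsLin-scale (proj₁ c₁) (rest s₂)))
  (symbolsLin-++⁻ (scale κ (proj₁ c₂) (rest s₁)) (scale κ (proj₁ c₁) (rest s₂)) f∈)

term-s₃⁻ : ∀ {κ} (c₁ c₂ : Num⁺ κ) s₁ s₂ {f} → f ∈ symbolsLin (term (s₃ c₁ c₂ s₁ s₂)) →
  f ∈ symbolsLin (term s₁) ⊎ f ∈ symbolsLin (term s₂)
term-s₃⁻ {κ} c₁ c₂ s₁ s₂ {f} f∈ with symbols-term⁻ (s₃ c₁ c₂ s₁ s₂) f∈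
... | inj₁ f∈ys = Sum.map (symbols-vars⁺ s₁) (symbols-vars⁺ s₂)
                    (∈-++⁻ (map (varSymbol κ) (vars s₁)) (≡.subst (f ∈_) (vars-s₃ c₁ c₂ s₁ s₂) f∈ys))
... | inj₂ f∈rest = Sum.map (symbols-rest⁺ s₁) (symbols-rest⁺ s₂) (rest-s₃⁻ c₁ c₂ s₁ s₂ f∈rest)

-- Interpretations and their variants

AgreeOn : ∀ {𝒟} → List Symbol → Interpretation 𝒟 → Interpretation 𝒟 → Set
AgreeOn fs ℐ ℐ′ = ∀ f → f ∈ fs → ∀ vs → ℐ f vs ≡ ℐ′ f vs

module _ {𝒟 : Domain} {ℐ ℐ′ : Interpretation 𝒟} where

  eval-cong : ∀ {τ} (t : Term τ) → AgreeOn (symbols t) ℐ ℐ′ → eval ℐ t ≡ eval ℐ′ t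
  evalArgs-cong : ∀ {σs} (ts : All (λ σ → Term (val σ)) σs) → AgreeOn (symbolsArgs ts) ℐ ℐ′ →
    evalArgs ℐ ts ≡ evalArgs ℐ′ ts
  evalLin-cong : ∀ {κ} (s : Lin κ) → AgreeOn (symbolsLin s) ℐ ℐ′ → evalLin ℐ s ≡ evalLin ℐ′ s

  eval-cong (app f ts) agree = trans
    (cong (ℐ _) (evalArgs-cong ts λ g g∈ → agree g (there g∈)))
    (agree _ (here refl) _)
  eval-cong (const κ q) agree = refl
  eval-cong (lin s)     agree = evalLin-cong s agree
  eval-cong ⌊ t / k ⌋   agree = cong (ℤ._/ℕ k) (eval-cong t agree)

  evalArgs-cong []       agree = refl
  evalArgs-cong (t ∷ ts) agree = cong₂ _∷_
    (eval-cong t λ g g∈ → agree g (∈-++⁺ˡ g∈))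
    (evalArgs-cong ts λ g g∈ → agree g (∈-++⁺ʳ (symbols t) g∈))

  evalLin-cong []            agree = refl
  evalLin-cong ((q , t) ∷ s) agree = cong₂ (λ v w → add _ (mul _ q v) w)
    (eval-cong t λ g g∈ → agree g (∈-++⁺ˡ g∈))
    (evalLin-cong s λ g g∈ → agree g (∈-++⁺ʳ (symbols t) g∈))

  holds-cong : ∀ ℓ → AgreeOn (symbolsLit ℓ) ℐ ℐ′ → holds ℐ ℓ ≡ holds ℐ′ ℓ
  holds-cong (s ≤ˡ c)  agree = cong (λ v → AtMost _ v c) (evalLin-cong s agree)
  holds-cong (t ≐ u)   agree = cong₂ _≡_
    (eval-cong t λ g g∈ → agree g (∈-++⁺ˡ g∈)) (eval-cong u λ g g∈ → agree g (∈-++⁺ʳ (symbols t) g∈))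
  holds-cong (t ≭ u)   agree = cong₂ _≢_
    (eval-cong t λ g g∈ → agree g (∈-++⁺ˡ g∈)) (eval-cong u λ g g∈ → agree g (∈-++⁺ʳ (symbols t) g∈))
  holds-cong (atom t)  agree = cong T (eval-cong t agree)
  holds-cong (natom t) agree = cong (λ b → ¬ T b) (eval-cong t agree)

  satisfies-cong : ∀ φ → AgreeOn (symb φ) ℐ ℐ′ → satisfies ℐ φ ≡ satisfies ℐ′ φ
  satisfies-cong (lit ℓ)  agree = holds-cong ℓ agree
  satisfies-cong ⊤ᶠ       agree = refl
  satisfies-cong ⊥ᶠ       agree = refl
  satisfies-cong (¬ᶠ φ)   agree = cong ¬_ (satisfies-cong φ agree)
  satisfies-cong (φ ∧ᶠ ψ) agree = cong₂ _×_
    (satisfies-cong φ λ g g∈ → agree g (∈-++⁺ˡ g∈)) (satisfies-cong ψ λ g g∈ → agree g (∈-++⁺ʳ (symb φ) g∈))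
  satisfies-cong (φ ∨ᶠ ψ) agree = cong₂ _⊎_
    (satisfies-cong φ λ g g∈ → agree g (∈-++⁺ˡ g∈)) (satisfies-cong ψ λ g g∈ → agree g (∈-++⁺ʳ (symb φ) g∈))

  transfer : ∀ φ → AgreeOn (symb φ) ℐ ℐ′ → satisfies ℐ φ → satisfies ℐ′ φ
  transfer φ agree = ≡.subst id (satisfies-cong φ agree)

AgreeOn-sym : ∀ {𝒟 fs} {ℐ ℐ′ : Interpretation 𝒟} → AgreeOn fs ℐ ℐ′ → AgreeOn fs ℐ′ ℐ
AgreeOn-sym agree f f∈ vs = sym (agree f f∈ vs)

AtMost? : ∀ κ v c → Dec (AtMost κ v c)
AtMost? int v c      = v ℤ.≤? c
AtMost? rat v ⌜ q ⌝  = v ℚ.≤? q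
AtMost? rat v (q -ε) = v ℚ.<? q

module _ {𝒟 : Domain} (ℐ : Interpretation 𝒟) where

  _≟ᵛ_ : ∀ {σ} (v w : ⟦_⟧ˢ 𝒟 σ) → Dec (v ≡ w)
  _≟ᵛ_ {arith int} = ℤ._≟_
  _≟ᵛ_ {arith rat} = ℚ._≟_
  _≟ᵛ_ {unint u}   = Domain._≟_ 𝒟

  holds? : ∀ ℓ → Dec (holds ℐ ℓ)
  holds? (s ≤ˡ c)  = AtMost? _ (evalLin ℐ s) c
  holds? (_≐_ {σ} t u) = _≟ᵛ_ {σ} (eval ℐ t) (eval ℐ u)
  holds? (_≭_ {σ} t u) = ¬? (_≟ᵛ_ {σ} (eval ℐ t) (eval ℐ u))
  holds? (atom t)  = T? (eval ℐ t)
  holds? (natom t) = ¬? (T? (eval ℐ t))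

  satisfies? : ∀ φ → Dec (satisfies ℐ φ)
  satisfies? (lit ℓ)  = holds? ℓ
  satisfies? ⊤ᶠ       = yes tt
  satisfies? ⊥ᶠ       = no λ ()
  satisfies? (¬ᶠ φ)   = ¬? (satisfies? φ)
  satisfies? (φ ∧ᶠ ψ) = satisfies? φ ×-dec satisfies? ψ
  satisfies? (φ ∨ᶠ ψ) = satisfies? φ ⊎-dec satisfies? ψ

assign : ∀ {𝒟 κ} → ℕ → Num κ → Interpretation 𝒟 → Interpretation 𝒟
assign {κ = κ} x v ℐ f with f ≟ varSymbol κ x
... | yes refl = λ _ → v
... | no _     = ℐ f

assign-same : ∀ {𝒟 κ} (ℐ : Interpretation 𝒟) x (v : Num κ) →
  eval (assign x v ℐ) {val (arith κ)} (var x) ≡ v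
assign-same {κ = κ} ℐ x v rewrite ≡.≡-≟-identity _≟_ {varSymbol κ x} refl = refl

assign-other : ∀ {𝒟 κ} (ℐ : Interpretation 𝒟) x (v : Num κ) {f} → f ≢ varSymbol κ x →
  ∀ vs → ℐ f vs ≡ assign x v ℐ f vs
assign-other {κ = κ} ℐ x v {f} f≢x vs with f ≟ varSymbol κ x
... | yes refl = contradiction refl f≢x
... | no _     = refl

assign-agree : ∀ {𝒟 κ} (ℐ : Interpretation 𝒟) x (v : Num κ) {fs} → varSymbol κ x ∉ fs →
  AgreeOn fs ℐ (assign x v ℐ)
assign-agree ℐ x v x∉ f f∈ = assign-other ℐ x v λ { refl → x∉ f∈ }

-- Substitution is assignment

module _ {κ : Arith} (x : ℕ) (u : Term (val (arith κ))) where

  module _ {𝒟 : Domain} (ℐ : Interpretation 𝒟) where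
    private ℐ′ = assign x (eval ℐ u) ℐ

    eval-subst : ∀ {τ} (t : Term τ) → eval ℐ (substTerm x u t) ≡ eval ℐ′ t
    evalArgs-subst : ∀ {σs} (ts : All (λ σ → Term (val σ)) σs) →
      evalArgs ℐ (substArgs x u ts) ≡ evalArgs ℐ′ ts
    evalLin-subst : ∀ {κ′} (s : Lin κ′) → evalLin ℐ (substLin x u s) ≡ evalLin ℐ′ s

    eval-subst (app f {σs} {τ} ts) with symbol f σs τ ≟ varSymbol κ x
    ... | yes refl = refl
    ... | no _     = cong (ℐ _) (evalArgs-subst ts)
    eval-subst (const κ′ q) = refl
    eval-subst (lin s)      = evalLin-subst s
    eval-subst ⌊ t / k ⌋    = cong (ℤ._/ℕ k) (eval-subst t)

    evalArgs-subst []       = refl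
    evalArgs-subst (t ∷ ts) = cong₂ _∷_ (eval-subst t) (evalArgs-subst ts)

    evalLin-subst []            = refl
    evalLin-subst ((q , t) ∷ s) =
      cong₂ (λ v w → add _ (mul _ q v) w) (eval-subst t) (evalLin-subst s)

    holds-subst : ∀ ℓ → holds ℐ (substLit x u ℓ) ≡ holds ℐ′ ℓ
    holds-subst (s ≤ˡ c)  = cong (λ v → AtMost _ v c) (evalLin-subst s)
    holds-subst (t ≐ t′)  = cong₂ _≡_ (eval-subst t) (eval-subst t′)
    holds-subst (t ≭ t′)  = cong₂ _≢_ (eval-subst t) (eval-subst t′)
    holds-subst (atom t)  = cong T (eval-subst t)
    holds-subst (natom t) = cong (λ b → ¬ T b) (eval-subst t)

    satisfies-subst : ∀ φ → satisfies ℐ (φ [ x ≔ u ]) ≡ satisfies ℐ′ φ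
    satisfies-subst (lit ℓ)  = holds-subst ℓ
    satisfies-subst ⊤ᶠ       = refl
    satisfies-subst ⊥ᶠ       = refl
    satisfies-subst (¬ᶠ φ)   = cong ¬_ (satisfies-subst φ)
    satisfies-subst (φ ∧ᶠ ψ) = cong₂ _×_ (satisfies-subst φ) (satisfies-subst ψ)
    satisfies-subst (φ ∨ᶠ ψ) = cong₂ _⊎_ (satisfies-subst φ) (satisfies-subst ψ)

  -- A bound on the symbols left by substitution: x itself disappears.
  Residual : List Symbol → Symbol → Set
  Residual fs f = (f ∈ fs × f ≢ varSymbol κ x) ⊎ f ∈ symbols u

  residual-⊆ : ∀ {fs gs f} → (∀ {g} → g ∈ fs → g ∈ gs) → Residual fs f → Residual gs f
  residual-⊆ fs⊆gs = Sum.map₁ λ (f∈ , f≢) → fs⊆gs f∈ , f≢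

  residual-++ : ∀ {fs gs} hs {f} → (f ∈ hs → Residual fs f) → ∀ {ks} → (f ∈ ks → Residual gs f) →
    f ∈ hs ++ ks → Residual (fs ++ gs) f
  residual-++ {fs} hs left right f∈ with ∈-++⁻ hs f∈
  ... | inj₁ f∈hs = residual-⊆ ∈-++⁺ˡ (left f∈hs)
  ... | inj₂ f∈ks = residual-⊆ (∈-++⁺ʳ fs) (right f∈ks)

  symbols-subst : ∀ {τ} (t : Term τ) {f} → f ∈ symbols (substTerm x u t) → Residual (symbols t) f
  symbolsArgs-subst : ∀ {σs} (ts : All (λ σ → Term (val σ)) σs) {f} →
    f ∈ symbolsArgs (substArgs x u ts) → Residual (symbolsArgs ts) f
  symbolsLin-subst : ∀ {κ′} (s : Lin κ′) {f} → f ∈ symbolsLin (substLin x u s) → Residual (symbolsLin s) f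

  symbols-subst (app f {σs} {τ} ts) f∈ with symbol f σs τ ≟ varSymbol κ x
  symbols-subst (app f ts) f∈         | yes refl = inj₂ f∈
  symbols-subst (app f ts) (here f≡)  | no f≢x   = inj₁ (here f≡ , λ g≡x → f≢x (trans (sym f≡) g≡x))
  symbols-subst (app f ts) (there f∈) | no _     = residual-⊆ there (symbolsArgs-subst ts f∈)
  symbols-subst (lin s)   f∈ = symbolsLin-subst s f∈
  symbols-subst ⌊ t / k ⌋ f∈ = symbols-subst t f∈

  symbolsArgs-subst (t ∷ ts) = residual-++ (symbols (substTerm x u t)) (symbols-subst t) (symbolsArgs-subst ts)

  symbolsLin-subst ((q , t) ∷ s) = residual-++ (symbols (substTerm x u t)) (symbols-subst t) (symbolsLin-subst s)

  symbolsLit-subst : ∀ ℓ {f} → f ∈ symbolsLit (substLit x u ℓ) → Residual (symbolsLit ℓ) f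
  symbolsLit-subst (s ≤ˡ c)  = symbolsLin-subst s
  symbolsLit-subst (t ≐ t′)  = residual-++ (symbols (substTerm x u t)) (symbols-subst t) (symbols-subst t′)
  symbolsLit-subst (t ≭ t′)  = residual-++ (symbols (substTerm x u t)) (symbols-subst t) (symbols-subst t′)
  symbolsLit-subst (atom t)  = symbols-subst t
  symbolsLit-subst (natom t) = symbols-subst t

  symb-subst : ∀ φ {f} → f ∈ symb (φ [ x ≔ u ]) → Residual (symb φ) f
  symb-subst (lit ℓ)  = symbolsLit-subst ℓ
  symb-subst (¬ᶠ φ)   = symb-subst φ
  symb-subst (φ ∧ᶠ ψ) = residual-++ (symb (φ [ x ≔ u ])) (symb-subst φ) (symb-subst ψ)
  symb-subst (φ ∨ᶠ ψ) = residual-++ (symb (φ [ x ≔ u ])) (symb-subst φ) (symb-subst ψ)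

-- The resolvent formula as an elimination

⋁-map⁻ : ∀ {𝒟} {X : Set} (ℐ : Interpretation 𝒟) (d : X → Formula) xs →
  satisfies ℐ (⋁ (map d xs)) → ∃[ x ] satisfies ℐ (d x)
⋁-map⁻ ℐ d (x ∷ xs) (inj₁ p) = x , p
⋁-map⁻ ℐ d (x ∷ xs) (inj₂ p) = ⋁-map⁻ ℐ d xs p

⋁-map⁺ : ∀ {𝒟} {X : Set} (ℐ : Interpretation 𝒟) (d : X → Formula) {xs x} → x ∈ xs →
  satisfies ℐ (d x) → satisfies ℐ (⋁ (map d xs))
⋁-map⁺ ℐ d (here refl) p = inj₁ p
⋁-map⁺ ℐ d (there x∈)  p = inj₂ (⋁-map⁺ ℐ d x∈ p)

symb-⋁-map⁻ : ∀ {X : Set} (d : X → Formula) xs {f} → f ∈ symb (⋁ (map d xs)) → ∃[ x ] f ∈ symb (d x)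
symb-⋁-map⁻ d (x ∷ xs) f∈ with ∈-++⁻ (symb (d x)) f∈
... | inj₁ f∈d  = x , f∈d
... | inj₂ f∈xs = symb-⋁-map⁻ d xs f∈xs

symbols-floorDiv : ∀ s c → symbols (floorDiv s c) ≡ symbolsLin s
symbols-floorDiv s (+[1+ n ] , _) = refl
symbols-floorDiv s (+ 0 , +<+ ())
symbols-floorDiv s (-[1+ _ ] , ())

At : ∀ {κ 𝒟} → ℕ → Formula → Interpretation 𝒟 → Num κ → Set
At x F ℐ v = satisfies (assign x v ℐ) F

-- The semantics of F₃: some common value of x₁ and - x₂ satisfies both formulae.
Eliminated : ∀ κ {𝒟} (x₁ x₂ : ℕ) (F₁ F₂ : Formula) → Interpretation 𝒟 → Set
Eliminated κ x₁ x₂ F₁ F₂ ℐ = ∃[ v ] At {κ} x₁ F₁ ℐ v × At {κ} x₂ F₂ ℐ (neg κ v)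

CutAt : ∀ {κ 𝒟} → Num⁺ κ → ℕ → Lin⁺ κ → Offset κ → Formula → Interpretation 𝒟 → Set
CutAt {κ} c x s k F ℐ = Cut κ c (evalLin ℐ (term s)) k (At x F ℐ)

substitute : ∀ {κ 𝒟} (ℐ : Interpretation 𝒟) x (u : Term (val (arith κ))) F {v} → eval ℐ u ≡ v →
  satisfies ℐ (F [ x ≔ u ]) ≡ satisfies (assign x v ℐ) F
substitute ℐ x u F refl = satisfies-subst x u ℐ F

cast : ∀ {X Y : Set} → X ≡ Y → X → Y
cast = ≡.subst id

module IntElimination (x₁ x₂ : ℕ) (c₁ c₂ : Num⁺ int) (s₁ s₂ : Lin⁺ int) (k₁ : ℤ) (F₁ F₂ : Formula) where

  fl : Term (val (arith int))
  fl = floorDiv (negate int (term s₁)) c₁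

  u₁ u₂ : ℕ → Term (val (arith int))
  u₁ i = lin ((+ 1 , fl) ∷ (-[1+ 0 ] , const int (+ i)) ∷ [])
  u₂ i = lin ((+ 1 , const int (+ i)) ∷ (-[1+ 0 ] , fl) ∷ [])

  disjunct : ℕ → Formula
  disjunct i = F₁ [ x₁ ≔ u₁ i ] ∧ᶠ F₂ [ x₂ ≔ u₂ i ]

  module _ {𝒟 : Domain} (ℐ : Interpretation 𝒟) where

    eval-u₁ : ∀ i → eval ℐ (u₁ i) ≡ eval ℐ fl ℤ.- + i
    eval-u₁ i = identity (eval ℐ fl) (+ i)
      where
      identity : ∀ q i → + 1 ℤ.* q ℤ.+ (-[1+ 0 ] ℤ.* i ℤ.+ + 0) ≡ q ℤ.- i
      identity = ℤ-solve-∀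

    eval-u₂ : ∀ i → eval ℐ (u₂ i) ≡ ℤ.- (eval ℐ fl ℤ.- + i)
    eval-u₂ i = identity (eval ℐ fl) (+ i)
      where
      identity : ∀ q i → + 1 ℤ.* i ℤ.+ (-[1+ 0 ] ℤ.* q ℤ.+ + 0) ≡ ℤ.- (q ℤ.- i)
      identity = ℤ-solve-∀

    fl-isFloor : IsFloor (ℤ.- evalLin ℐ (term s₁)) c₁ (eval ℐ fl)
    fl-isFloor = ≡.subst (λ n → IsFloor n c₁ (eval ℐ fl)) (evalLin-negate ℐ (term s₁))
      (floorDiv-isFloor ℐ (negate int (term s₁)) c₁)

    sound : satisfies ℐ (F₃ int x₁ x₂ c₁ c₂ s₁ s₂ k₁ F₁ F₂) → Eliminated int x₁ x₂ F₁ F₂ ℐ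
    sound f₃ =
      let i , p₁ , p₂ = ⋁-map⁻ ℐ disjunct (upTo (suc (ceilDiv (k₁ ℤ.+ + 1) c₁))) f₃ in
      eval ℐ fl ℤ.- + i , cast (substitute ℐ x₁ (u₁ i) F₁ (eval-u₁ i)) p₁
                        , cast (substitute ℐ x₂ (u₂ i) F₂ (eval-u₂ i)) p₂

    complete : ∀ {k₂} → CutAt c₁ x₁ s₁ k₁ F₁ ℐ → CutAt c₂ x₂ s₂ k₂ F₂ ℐ →
      Eliminated int x₁ x₂ F₁ F₂ ℐ → satisfies ℐ (F₃ int x₁ x₂ c₁ c₂ s₁ s₂ k₁ F₁ F₂)
    complete cut₁ cut₂ (v , p₁ , p₂) =
      let i , i≤N , q₁ , q₂ = int-cuts⇒disjunct cut₁ cut₂ fl-isFloor p₁ p₂ in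
      ⋁-map⁺ ℐ disjunct (∈-upTo⁺ (s≤s i≤N))
        ( cast (sym (substitute ℐ x₁ (u₁ i) F₁ (eval-u₁ i))) q₁
        , cast (sym (substitute ℐ x₂ (u₂ i) F₂ (eval-u₂ i))) q₂ )

module RatElimination (x₁ x₂ : ℕ) (c₁ c₂ : Num⁺ rat) (s₁ s₂ : Lin⁺ rat) (F₁ F₂ : Formula) where

  quotient : Lin rat
  quotient = scale rat (reciprocal c₁) (term s₁)

  module _ {𝒟 : Domain} (ℐ : Interpretation 𝒟) where
    σ₁ = evalLin ℐ (term s₁)

    eval-quotient : evalLin ℐ quotient ≡ reciprocal c₁ ℚ.* σ₁
    eval-quotient = evalLin-scale ℐ (reciprocal c₁) (term s₁)

    eval-neg-quotient : evalLin ℐ (negate rat quotient) ≡ ℚ.- (reciprocal c₁ ℚ.* σ₁)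
    eval-neg-quotient = trans (evalLin-negate ℐ quotient) (cong ℚ.-_ eval-quotient)

    sound : ∀ {k₁ k₂} → CutAt c₁ x₁ s₁ k₁ F₁ ℐ → CutAt c₂ x₂ s₂ k₂ F₂ ℐ →
      satisfies ℐ (F₃ rat x₁ x₂ c₁ c₂ s₁ s₂ k₁ F₁ F₂) → Eliminated rat x₁ x₂ F₁ F₂ ℐ
    sound { -εᵒ} cut₁ cut₂ p₂ =
      rat-quotient⇒cuts cut₁ cut₂ (cast (substitute ℐ x₂ (lin quotient) F₂ eval-quotient) p₂)
    sound {0ᵒ} cut₁ cut₂ (inj₁ s₃<0) =
      rat-gap cut₁ cut₂ (≡.subst (ℚ._< 0ℚ) (evalLin-s₃ ℐ c₁ c₂ s₁ s₂) s₃<0)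
    sound {0ᵒ} cut₁ cut₂ (inj₂ (p₁ , p₂)) =
      ℚ.- q , cast (substitute ℐ x₁ (lin (negate rat quotient)) F₁ eval-neg-quotient) p₁
            , cast (substitute ℐ x₂ (lin quotient) F₂ (trans eval-quotient (sym (-‿involutive {rat} q)))) p₂
      where q = reciprocal c₁ ℚ.* σ₁

    complete : ∀ {k₁ k₂} → CutAt c₁ x₁ s₁ k₁ F₁ ℐ → CutAt c₂ x₂ s₂ k₂ F₂ ℐ →
      Eliminated rat x₁ x₂ F₁ F₂ ℐ → satisfies ℐ (F₃ rat x₁ x₂ c₁ c₂ s₁ s₂ k₁ F₁ F₂)
    complete {k₁} cut₁ cut₂ (v , p₁ , p₂) = byOffset k₁
      where
      q₂ : satisfies ℐ (F₂ [ x₂ ≔ lin quotient ])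
      q₂ = cast (sym (substitute ℐ x₂ (lin quotient) F₂ eval-quotient)) (rat-cuts⇒quotient cut₁ cut₂ p₁ p₂)
      byOffset : ∀ k → satisfies ℐ (F₃ rat x₁ x₂ c₁ c₂ s₁ s₂ k F₁ F₂)
      byOffset -εᵒ = q₂
      byOffset 0ᵒ with rat-cuts⇒disjunct cut₁ cut₂ p₁ p₂
      ... | inj₁ σ₃<0 = inj₁ (≡.subst (ℚ._< 0ℚ) (sym (evalLin-s₃ ℐ c₁ c₂ s₁ s₂)) σ₃<0)
      ... | inj₂ q₁ = inj₂ (cast (sym (substitute ℐ x₁ (lin (negate rat quotient)) F₁ eval-neg-quotient)) q₁ , q₂)

module _ {𝒟 : Domain} (ℐ : Interpretation 𝒟) where

  F₃-sound : ∀ κ x₁ x₂ (c₁ c₂ : Num⁺ κ) s₁ s₂ k₁ k₂ F₁ F₂ →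
    CutAt c₁ x₁ s₁ k₁ F₁ ℐ → CutAt c₂ x₂ s₂ k₂ F₂ ℐ →
    satisfies ℐ (F₃ κ x₁ x₂ c₁ c₂ s₁ s₂ k₁ F₁ F₂) → Eliminated κ x₁ x₂ F₁ F₂ ℐ
  F₃-sound int x₁ x₂ c₁ c₂ s₁ s₂ k₁ k₂ F₁ F₂ cut₁ cut₂ =
    IntElimination.sound x₁ x₂ c₁ c₂ s₁ s₂ k₁ F₁ F₂ ℐ
  F₃-sound rat x₁ x₂ c₁ c₂ s₁ s₂ k₁ k₂ F₁ F₂ = RatElimination.sound x₁ x₂ c₁ c₂ s₁ s₂ F₁ F₂ ℐ

  F₃-complete : ∀ κ x₁ x₂ (c₁ c₂ : Num⁺ κ) s₁ s₂ k₁ k₂ F₁ F₂ →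
    CutAt c₁ x₁ s₁ k₁ F₁ ℐ → CutAt c₂ x₂ s₂ k₂ F₂ ℐ →
    Eliminated κ x₁ x₂ F₁ F₂ ℐ → satisfies ℐ (F₃ κ x₁ x₂ c₁ c₂ s₁ s₂ k₁ F₁ F₂)
  F₃-complete int x₁ x₂ c₁ c₂ s₁ s₂ k₁ k₂ F₁ F₂ = IntElimination.complete x₁ x₂ c₁ c₂ s₁ s₂ k₁ F₁ F₂ ℐ
  F₃-complete rat x₁ x₂ c₁ c₂ s₁ s₂ k₁ k₂ F₁ F₂ = RatElimination.complete x₁ x₂ c₁ c₂ s₁ s₂ F₁ F₂ ℐ

  F₃-true-below : ∀ κ x₁ x₂ (c₁ c₂ : Num⁺ κ) s₁ s₂ k₁ k₂ F₁ F₂ →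
    CutAt c₁ x₁ s₁ k₁ F₁ ℐ → CutAt c₂ x₂ s₂ k₂ F₂ ℐ →
    BelowNeg κ (evalLin ℐ (term (s₃ c₁ c₂ s₁ s₂))) (k₃ κ c₁ c₂ k₁ k₂) →
    satisfies ℐ (F₃ κ x₁ x₂ c₁ c₂ s₁ s₂ k₁ F₁ F₂)
  F₃-true-below κ x₁ x₂ c₁ c₂ s₁ s₂ k₁ k₂ F₁ F₂ cut₁ cut₂ s₃< =
    F₃-complete κ x₁ x₂ c₁ c₂ s₁ s₂ k₁ k₂ F₁ F₂ cut₁ cut₂
      (cuts-meet κ cut₁ cut₂ (≡.subst (λ v → BelowNeg κ v (k₃ κ c₁ c₂ k₁ k₂)) (evalLin-s₃ ℐ c₁ c₂ s₁ s₂) s₃<))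

  F₃-false-above : ∀ κ x₁ x₂ (c₁ c₂ : Num⁺ κ) s₁ s₂ k₁ k₂ F₁ F₂ →
    CutAt c₁ x₁ s₁ k₁ F₁ ℐ → CutAt c₂ x₂ s₂ k₂ F₂ ℐ →
    satisfies ℐ (F₃ κ x₁ x₂ c₁ c₂ s₁ s₂ k₁ F₁ F₂) →
    Leq κ (evalLin ℐ (term (s₃ c₁ c₂ s₁ s₂))) (0# κ)
  F₃-false-above κ x₁ x₂ c₁ c₂ s₁ s₂ k₁ k₂ F₁ F₂ cut₁ cut₂ f₃ =
    let v , p₁ , p₂ = F₃-sound κ x₁ x₂ c₁ c₂ s₁ s₂ k₁ k₂ F₁ F₂ cut₁ cut₂ f₃ in
    ≡.subst (λ σ → Leq κ σ (0# κ)) (sym (evalLin-s₃ ℐ c₁ c₂ s₁ s₂)) (cuts-bound cut₁ cut₂ p₁ p₂)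

symb-F₃ : ∀ κ x₁ x₂ (c₁ c₂ : Num⁺ κ) s₁ s₂ k₁ F₁ F₂ {f} → f ∈ symb (F₃ κ x₁ x₂ c₁ c₂ s₁ s₂ k₁ F₁ F₂) →
  ((f ∈ symb F₁ × f ≢ varSymbol κ x₁) ⊎ (f ∈ symb F₂ × f ≢ varSymbol κ x₂)) ⊎
  (f ∈ symbolsLin (term s₁) ⊎ f ∈ symbolsLin (term s₂))
symb-F₃ int x₁ x₂ c₁ c₂ s₁ s₂ k₁ F₁ F₂ {f} f∈ = splitDisjunct (∈-++⁻ (symb (F₁ [ x₁ ≔ u₁ i ])) f∈i)
  where
  open IntElimination x₁ x₂ c₁ c₂ s₁ s₂ k₁ F₁ F₂
  occurrence : ∃[ i ] f ∈ symb (disjunct i)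
  occurrence = symb-⋁-map⁻ disjunct (upTo (suc (ceilDiv (k₁ ℤ.+ + 1) c₁))) f∈
  i = proj₁ occurrence
  f∈i = proj₂ occurrence
  symbols-fl : f ∈ symbols fl ++ [] → f ∈ symbolsLin (term s₁)
  symbols-fl f∈fl = ≡.subst (f ∈_)
    (trans (++-identityʳ _) (trans (symbols-floorDiv (negate int (term s₁)) c₁) (symbolsLin-negate (term s₁)))) f∈fl
  splitDisjunct : f ∈ symb (F₁ [ x₁ ≔ u₁ i ]) ⊎ f ∈ symb (F₂ [ x₂ ≔ u₂ i ]) → _
  splitDisjunct (inj₁ f∈₁) = Sum.map inj₁ (inj₁ ∘ symbols-fl) (symb-subst x₁ (u₁ i) F₁ f∈₁)
  splitDisjunct (inj₂ f∈₂) = Sum.map inj₂ (inj₁ ∘ symbols-fl) (symb-subst x₂ (u₂ i) F₂ f∈₂)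
symb-F₃ rat x₁ x₂ c₁ c₂ s₁ s₂ k₁ F₁ F₂ {f} = byOffset k₁
  where
  open RatElimination x₁ x₂ c₁ c₂ s₁ s₂ F₁ F₂
  symbols-quotient : f ∈ symbolsLin quotient → f ∈ symbolsLin (term s₁)
  symbols-quotient = ≡.subst (f ∈_) (symbolsLin-scale (reciprocal c₁) (term s₁))
  in-F₂ : f ∈ symb (F₂ [ x₂ ≔ lin quotient ]) → _
  in-F₂ f∈₂ = Sum.map inj₂ (inj₁ ∘ symbols-quotient) (symb-subst x₂ (lin quotient) F₂ f∈₂)
  byOffset : ∀ k → f ∈ symb (F₃ rat x₁ x₂ c₁ c₂ s₁ s₂ k F₁ F₂) → _
  byOffset -εᵒ f∈ = in-F₂ f∈
  byOffset 0ᵒ f∈ with ∈-++⁻ (symbolsLin (term (s₃ c₁ c₂ s₁ s₂))) f∈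
  ... | inj₁ f∈s₃ = inj₂ (term-s₃⁻ c₁ c₂ s₁ s₂ f∈s₃)
  ... | inj₂ f∈ᵣ with ∈-++⁻ (symb (F₁ [ x₁ ≔ lin (negate rat quotient) ])) f∈ᵣ
  ...   | inj₂ f∈₂ = in-F₂ f∈₂
  ...   | inj₁ f∈₁ = Sum.map inj₁ (inj₁ ∘ symbols-quotient ∘ ≡.subst (f ∈_) (symbolsLin-negate quotient))
                       (symb-subst x₁ (lin (negate rat quotient)) F₁ f∈₁)

-- Contexts

leaves-plug⁻ : ∀ I {G P} → P ∈ leaves (I [ G ]) → just P ∈ leaves I ⊎ P ∈ leaves G
leaves-plug⁻ (I ∧ⁿ J) {G} P∈ with ∈-++⁻ (leaves (I [ G ])) P∈
... | inj₁ P∈I = Sum.map₁ ∈-++⁺ˡ (leaves-plug⁻ I P∈I)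
... | inj₂ P∈J = Sum.map₁ (∈-++⁺ʳ (leaves I)) (leaves-plug⁻ J P∈J)
leaves-plug⁻ (I ∨ⁿ J) {G} P∈ with ∈-++⁻ (leaves (I [ G ])) P∈
... | inj₁ P∈I = Sum.map₁ ∈-++⁺ˡ (leaves-plug⁻ I P∈I)
... | inj₂ P∈J = Sum.map₁ (∈-++⁺ʳ (leaves I)) (leaves-plug⁻ J P∈J)
leaves-plug⁻ (leaf (just P)) (here refl) = inj₁ (here refl)
leaves-plug⁻ (leaf nothing)  P∈          = inj₂ P∈

leaves-plug⁺ : ∀ I {G P} → just P ∈ leaves I ⊎ (HoleOccurs I × P ∈ leaves G) → P ∈ leaves (I [ G ])
leaves-plug⁺ I {G} {P} = [ context I , (λ (hole , P∈) → inHole I hole P∈) ]′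
  where
  context : ∀ I → just P ∈ leaves I → P ∈ leaves (I [ G ])
  context (I ∧ⁿ J) P∈ with ∈-++⁻ (leaves I) P∈
  ... | inj₁ P∈I = ∈-++⁺ˡ (context I P∈I)
  ... | inj₂ P∈J = ∈-++⁺ʳ (leaves (I [ G ])) (context J P∈J)
  context (I ∨ⁿ J) P∈ with ∈-++⁻ (leaves I) P∈
  ... | inj₁ P∈I = ∈-++⁺ˡ (context I P∈I)
  ... | inj₂ P∈J = ∈-++⁺ʳ (leaves (I [ G ])) (context J P∈J)
  context (leaf (just P)) (here refl) = here refl
  context (leaf nothing) (here ())
  inHole : ∀ I → HoleOccurs I → P ∈ leaves G → P ∈ leaves (I [ G ])
  inHole (I ∧ⁿ J) hole P∈ with ∈-++⁻ (leaves I) hole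
  ... | inj₁ hole∈I = ∈-++⁺ˡ (inHole I hole∈I P∈)
  ... | inj₂ hole∈J = ∈-++⁺ʳ (leaves (I [ G ])) (inHole J hole∈J P∈)
  inHole (I ∨ⁿ J) hole P∈ with ∈-++⁻ (leaves I) hole
  ... | inj₁ hole∈I = ∈-++⁺ˡ (inHole I hole∈I P∈)
  ... | inj₂ hole∈J = ∈-++⁺ʳ (leaves (I [ G ])) (inHole J hole∈J P∈)
  inHole (leaf nothing) hole P∈ = P∈
  inHole (leaf (just _)) (here ()) P∈

literals-plug⁻ : ∀ I {G ℓ} → ℓ ∈ literals (I [ G ]) → ℓ ∈ literals I ⊎ ℓ ∈ literals G
literals-plug⁻ (lit ℓ) ℓ∈ = inj₁ ℓ∈
literals-plug⁻ (I ∧ⁿ J) {G} ℓ∈ with ∈-++⁻ (literals (I [ G ])) ℓ∈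
... | inj₁ ℓ∈I = Sum.map₁ ∈-++⁺ˡ (literals-plug⁻ I ℓ∈I)
... | inj₂ ℓ∈J = Sum.map₁ (∈-++⁺ʳ (literals I)) (literals-plug⁻ J ℓ∈J)
literals-plug⁻ (I ∨ⁿ J) {G} ℓ∈ with ∈-++⁻ (literals (I [ G ])) ℓ∈
... | inj₁ ℓ∈I = Sum.map₁ ∈-++⁺ˡ (literals-plug⁻ I ℓ∈I)
... | inj₂ ℓ∈J = Sum.map₁ (∈-++⁺ʳ (literals I)) (literals-plug⁻ J ℓ∈J)
literals-plug⁻ (leaf nothing) ℓ∈ = inj₂ ℓ∈

literals-plug⁺ : ∀ I {G} → literals I ⊆ literals (I [ G ])
literals-plug⁺ (lit ℓ)  = id
literals-plug⁺ (I ∧ⁿ J) = ++⁺ (literals-plug⁺ I) (literals-plug⁺ J)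
literals-plug⁺ (I ∨ⁿ J) = ++⁺ (literals-plug⁺ I) (literals-plug⁺ J)
literals-plug⁺ (leaf _) ()

concatMap∈ : ∀ {X Y : Set} (g : X → List Y) {x xs y} → x ∈ xs → y ∈ g x → y ∈ concatMap g xs
concatMap∈ g x∈ y∈ = ∈-concatMap⁺ g (lose x∈ y∈)

symbContext-⊆ : ∀ {I J : Context} → literals I ⊆ literals J → leaves I ⊆ leaves J →
  symbContext I ⊆ symbContext J
symbContext-⊆ ls⊆ vs⊆ = ++⁺ (concatMap⁺ symbolsLit ls⊆) (concatMap⁺ symbMaybe vs⊆)

symbInterpolant-plug⁻ : ∀ I {G f} → f ∈ symbInterpolant (I [ G ]) → f ∈ symbContext I ⊎ f ∈ symbInterpolant G
symbInterpolant-plug⁻ I {G} f∈ with ∈-++⁻ (concatMap symbolsLit (literals (I [ G ]))) f∈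
... | inj₁ f∈ls with ℓ , ℓ∈ , f∈ℓ ← find (∈-concatMap⁻ symbolsLit {xs = literals (I [ G ])} f∈ls) =
  Sum.map (λ ℓ∈I → ∈-++⁺ˡ (concatMap∈ symbolsLit ℓ∈I f∈ℓ)) (λ ℓ∈G → ∈-++⁺ˡ (concatMap∈ symbolsLit ℓ∈G f∈ℓ))
    (literals-plug⁻ I ℓ∈)
... | inj₂ f∈vs with P , P∈ , f∈P ← find (∈-concatMap⁻ symbPattern {xs = leaves (I [ G ])} f∈vs) =
  Sum.map (λ P∈I → ∈-++⁺ʳ (concatMap symbolsLit (literals I)) (concatMap∈ symbMaybe P∈I f∈P))
          (λ P∈G → ∈-++⁺ʳ (concatMap symbolsLit (literals G)) (concatMap∈ symbPattern P∈G f∈P))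
    (leaves-plug⁻ I P∈)

symbContext-plug⁺ : ∀ I {G} → symbContext I ⊆ symbInterpolant (I [ G ])
symbContext-plug⁺ I {G} f∈ with ∈-++⁻ (concatMap symbolsLit (literals I)) f∈
... | inj₁ f∈ls = ∈-++⁺ˡ (concatMap⁺ symbolsLit (literals-plug⁺ I) f∈ls)
... | inj₂ f∈vs with find (∈-concatMap⁻ symbMaybe {xs = leaves I} f∈vs)
...   | just P , P∈ , f∈P = ∈-++⁺ʳ (concatMap symbolsLit (literals (I [ G ])))
          (concatMap∈ symbPattern (leaves-plug⁺ I (inj₁ P∈)) f∈P)

symbPattern-plug⁺ : ∀ I {P} → HoleOccurs I → symbPattern P ⊆ symbInterpolant (I [ leaf P ])
symbPattern-plug⁺ I {P} hole f∈ = ∈-++⁺ʳ (concatMap symbolsLit (literals (I [ leaf P ])))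
  (concatMap∈ symbPattern (leaves-plug⁺ I (inj₂ (hole , here refl))) f∈)

-- Holes occur only positively, so an implication between their fillings lifts to the whole;
-- the two sides may be read in different interpretations that agree on the context.
plug : ∀ I {G G′ 𝒟} {ℐ ℐ′ : Interpretation 𝒟} → AgreeOn (symbContext I) ℐ ℐ′ →
  (satisfies ℐ ⌊ G ⌋ → satisfies ℐ′ ⌊ G′ ⌋) → satisfies ℐ ⌊ I [ G ] ⌋ → satisfies ℐ′ ⌊ I [ G′ ] ⌋
plug (lit ℓ) agree imp h =
  transfer (lit ℓ) (λ f f∈ → agree f (∈-++⁺ˡ (∈-++⁺ˡ f∈))) h
plug ⊤ⁿ agree imp h = h
plug (I ∧ⁿ J) agree imp (hI , hJ) =
    plug I (λ f f∈ → agree f (symbContext-⊆ {I} {I ∧ⁿ J} (xs⊆xs++ys _ _) (xs⊆xs++ys _ _) f∈)) imp hI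
  , plug J (λ f f∈ → agree f (symbContext-⊆ {J} {I ∧ⁿ J} (xs⊆ys++xs _ _) (xs⊆ys++xs _ _) f∈)) imp hJ
plug (I ∨ⁿ J) agree imp (inj₁ hI) = inj₁
  (plug I (λ f f∈ → agree f (symbContext-⊆ {I} {I ∨ⁿ J} (xs⊆xs++ys _ _) (xs⊆xs++ys _ _) f∈)) imp hI)
plug (I ∨ⁿ J) agree imp (inj₂ hJ) = inj₂
  (plug J (λ f f∈ → agree f (symbContext-⊆ {J} {I ∨ⁿ J} (xs⊆ys++xs _ _) (xs⊆ys++xs _ _) f∈)) imp hJ)
plug (leaf (just P)) agree imp h =
  transfer (Pattern.formula P) (λ f f∈ → agree f (∈-++⁺ˡ (∈-++⁺ʳ (symbolsLin (term (Pattern.linear P))) f∈))) h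
plug (leaf nothing) agree imp h = imp h

-- Filters, conjunctions and bounds

filter-map : ∀ {X Y : Set} {p} {P : Pred Y p} (P? : Decidable P) (f : X → Y) xs →
  filter P? (map f xs) ≡ map f (filter (P? ∘ f) xs)
filter-map P? f []       = refl
filter-map P? f (x ∷ xs) with P? (f x)
... | yes _ = cong (f x ∷_) (filter-map P? f xs)
... | no _  = filter-map P? f xs

symbolsLin-filter : ∀ {κ p} {P : Pred (Num κ × Term (val (arith κ))) p} (P? : Decidable P) (s : Lin κ) →
  symbolsLin (filter P? s) ⊆ symbolsLin s
symbolsLin-filter P? ((q , t) ∷ s) f∈ with P? (q , t)
... | no _ = ∈-++⁺ʳ (symbols t) (symbolsLin-filter P? s f∈)
... | yes _ with ∈-++⁻ (symbols t) f∈
...   | inj₁ f∈t = ∈-++⁺ˡ f∈t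
...   | inj₂ f∈s = ∈-++⁺ʳ (symbols t) (symbolsLin-filter P? s f∈s)

⋀-++⁻ : ∀ {𝒟} {X : Set} (ℐ : Interpretation 𝒟) (g : X → Formula) xs {ys} →
  satisfies ℐ (⋀ (map g (xs ++ ys))) → satisfies ℐ (⋀ (map g xs)) × satisfies ℐ (⋀ (map g ys))
⋀-++⁻ ℐ g []       h       = tt , h
⋀-++⁻ ℐ g (x ∷ xs) (p , h) = Product.map₁ (p ,_) (⋀-++⁻ ℐ g xs h)

symb-⋀-map⁻ : ∀ {X : Set} (g : X → Formula) xs {f} → f ∈ symb (⋀ (map g xs)) → ∃[ x ] x ∈ xs × f ∈ symb (g x)
symb-⋀-map⁻ g (x ∷ xs) f∈ with ∈-++⁻ (symb (g x)) f∈
... | inj₁ f∈x  = x , here refl , f∈x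
... | inj₂ f∈xs = let y , y∈ , f∈y = symb-⋀-map⁻ g xs f∈xs in y , there y∈ , f∈y

Leq-refl : ∀ κ {v w} → v ≡ w → Leq κ v w
Leq-refl int = ℤ.≤-reflexive
Leq-refl rat = ℚ.≤-reflexive

Leq-≮ : ∀ κ {v} → ¬ Less κ (0# κ) v → Leq κ v (0# κ)
Leq-≮ int = ℤ.≮⇒≥
Leq-≮ rat = ℚ.≮⇒≥

Leq⇒≮ : ∀ κ {v} → Leq κ v (0# κ) → ¬ Less κ (0# κ) v
Leq⇒≮ int = ℤ.≤⇒≯
Leq⇒≮ rat v≤0 0<v = ℚ.<-irrefl refl (ℚ.<-≤-trans 0<v v≤0)

AtMost-0ᵇ : ∀ κ {v} → v ≡ 0# κ → AtMost κ v (0ᵇ κ)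
AtMost-0ᵇ int = ℤ.≤-reflexive
AtMost-0ᵇ rat = ℚ.≤-reflexive

AtMost-neg : ∀ κ c {v} → ¬ AtMost κ v c → AtMost κ (neg κ v) (negBound κ c)
AtMost-neg int c {v} v≰c = ≡.subst (ℤ.- v ℤ.≤_) (identity c)
  (ℤ.neg-mono-≤ (ℤ.i<j⇒suc[i]≤j (ℤ.≰⇒> v≰c)))
  where
  identity : ∀ c → ℤ.- (+ 1 ℤ.+ c) ≡ ℤ.- c ℤ.- + 1
  identity = ℤ-solve-∀
AtMost-neg rat ⌜ q ⌝  v≰q = ℚ.neg-antimono-< (ℚ.≰⇒> v≰q)
AtMost-neg rat (q -ε) v≮q = ℚ.neg-antimono-≤ (ℚ.≮⇒≥ v≮q)

-- A B-projection - x + b ≤ c constrains the auxiliary variable x from below only.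
AtMost-slack : ∀ κ b c → ∃[ v ] AtMost κ (add κ (neg κ v) b) c
AtMost-slack int b c = b ℤ.- c , ℤ.≤-reflexive (identity b c)
  where
  identity : ∀ b c → ℤ.- (b ℤ.- c) ℤ.+ b ≡ c
  identity = ℤ-solve-∀
AtMost-slack rat b ⌜ q ⌝ = b ℚ.- q , ℚ.≤-reflexive (identity b q)
  where
  identity : ∀ b q → ℚ.- (b ℚ.- q) ℚ.+ b ≡ q
  identity = ℚ-solve 2 (λ b q →
    (:- (b :- q) :+ b) := q) refl
AtMost-slack rat b (q -ε) = b ℚ.- (q ℚ.- 1ℚ) , (begin-strict
  ℚ.- (b ℚ.- (q ℚ.- 1ℚ)) ℚ.+ b  ≡⟨ identity b (q ℚ.- 1ℚ) ⟩
  q ℚ.- 1ℚ                      <⟨ ℚ.+-monoʳ-< q (ℚ.negative⁻¹ (ℚ.- 1ℚ)) ⟩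
  q ℚ.+ 0ℚ                      ≡⟨ ℚ.+-identityʳ q ⟩
  q                             ∎)
  where
  open ℚ.≤-Reasoning
  identity : ∀ b q → ℚ.- (b ℚ.- q) ℚ.+ b ≡ q
  identity = ℚ-solve 2 (λ b q →
    (:- (b :- q) :+ b) := q) refl

-- Monotonicity

override : ∀ {𝒟} → List Symbol → Interpretation 𝒟 → Interpretation 𝒟 → Interpretation 𝒟
override fs ℐ ℐ′ f with f ∈? fs
... | yes _ = ℐ′ f
... | no _  = ℐ f

_≤[_]_ : ∀ {𝒟 κ} → Interpretation 𝒟 → List ℕ → Interpretation 𝒟 → Set
_≤[_]_ {κ = κ} ℐ′ ys ℐ = ∀ y → y ∈ ys →
  Leq κ (eval ℐ′ {val (arith κ)} (var y)) (eval ℐ {val (arith κ)} (var y))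

-- Monotonicity compares interpretations that agree on all other symbols.  Agreement on the
-- symbols of F is enough: pass through the interpretation that changes only the variables ys.
monotone-on-symb : ∀ {κ ys F 𝒟} {ℐ ℐ′ : Interpretation 𝒟} → Monotone κ ys F →
  (∀ f → f ∈ symb F → f ∉ map (varSymbol κ) ys → ∀ vs → ℐ f vs ≡ ℐ′ f vs) →
  _≤[_]_ {κ = κ} ℐ′ ys ℐ → satisfies ℐ F → satisfies ℐ′ F
monotone-on-symb {κ} {ys} {F} {𝒟} {ℐ} {ℐ′} monotone agree ℐ′≤ℐ h =
  transfer F agree′ (monotone 𝒟 ℐ hybrid off-ys (λ y y∈ → ≡.subst (λ v → Leq κ v _) (sym (on-ys y∈)) (ℐ′≤ℐ y y∈)) h)
  where
  fs = map (varSymbol κ) ys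
  hybrid = override fs ℐ ℐ′
  off-ys : ∀ f → f ∉ fs → ∀ vs → ℐ f vs ≡ hybrid f vs
  off-ys f f∉ vs with f ∈? fs
  ... | yes f∈ = contradiction f∈ f∉
  ... | no _   = refl
  on-ys : ∀ {y} → y ∈ ys → hybrid (varSymbol κ y) [] ≡ ℐ′ (varSymbol κ y) []
  on-ys {y} y∈ with varSymbol κ y ∈? fs
  ... | yes _ = refl
  ... | no y∉ = contradiction (∈-map⁺ (varSymbol κ) y∈) y∉
  agree′ : AgreeOn (symb F) hybrid ℐ′
  agree′ f f∈ vs with f ∈? fs
  ... | yes _ = refl
  ... | no f∉ = agree f f∈ f∉ vs

assign-≤ : ∀ {κ 𝒟} {ℐ ℐ′ : Interpretation 𝒟} x {v w : Num κ} {ys} → Leq κ v w → _≤[_]_ {κ = κ} ℐ′ ys ℐ →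
  _≤[_]_ {κ = κ} (assign x v ℐ′) (x ∷ ys) (assign x w ℐ)
assign-≤ {κ} {ℐ = ℐ} {ℐ′} x {v} {w} v≤w ℐ′≤ℐ y y∈ with varSymbol κ y ≟ varSymbol κ x
... | yes refl = v≤w
assign-≤ x v≤w ℐ′≤ℐ y (here refl) | no y≢x = contradiction refl y≢x
assign-≤ x v≤w ℐ′≤ℐ y (there y∈)  | no y≢x = ℐ′≤ℐ y y∈

assign-agree-off : ∀ {κ 𝒟} (ℐ ℐ′ : Interpretation 𝒟) x (v w : Num κ) f → f ≢ varSymbol κ x →
  (∀ vs → ℐ f vs ≡ ℐ′ f vs) → ∀ vs → assign x v ℐ f vs ≡ assign x w ℐ′ f vs
assign-agree-off ℐ ℐ′ x v w f f≢x ℐ≡ℐ′ vs =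
  trans (sym (assign-other ℐ x v f≢x vs)) (trans (ℐ≡ℐ′ vs) (assign-other ℐ′ x w f≢x vs))

-- The resolvent pattern is well formed

varSymbol-injective : ∀ {κ x y} → varSymbol κ x ≡ varSymbol κ y → x ≡ y
varSymbol-injective refl = refl

module Patterns (𝒮 : Setting) where
  open Setting 𝒮

  module _ {κ} {c : Num⁺ κ} {x} {s : Lin⁺ κ} {k F} (wf : WellFormed (LA (c · x ⊞ s) k F)) where
    open WellFormed wf

    vars⇒IneqAux : ∀ {f} → f ∈ map (varSymbol κ) (vars s) → IsIneqAux f
    vars⇒IneqAux f∈ = All.lookup vars-aux (there f∈)

    module _ (x∉s : x ∉ vars s) where

      ∉term : varSymbol κ x ∉ symbolsLin (term s)
      ∉term x∈ with symbols-term⁻ s x∈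
      ... | inj₂ x∈rest = rest-free (varSymbol κ x) (here refl) x∈rest
      ... | inj₁ x∈ys with y , y∈ , x≡y ← ∈-map⁻ (varSymbol κ) x∈ys =
        x∉s (≡.subst (_∈ vars s) (sym (varSymbol-injective x≡y)) y∈)

      pattern-cut : ∀ {𝒟} (ℐ : Interpretation 𝒟) → CutAt c x s k F ℐ
      pattern-cut {𝒟} ℐ = record
        { lower   = λ {v} {w} v≤w → monotone 𝒟 (assign x w ℐ) (assign x v ℐ)
            (λ f f∉ → assign-agree-off ℐ ℐ x w v f (λ { refl → f∉ (here refl) }) (λ _ → refl))
            (assign-≤ x v≤w (λ y _ → Leq-refl κ refl))
        ; bounded = λ {v} p → ≡.subst (λ σ → Leq κ σ (0# κ)) (value v)
            (Leq-≮ κ λ 0<σ → false-above 𝒟 (assign x v ℐ) 0<σ p)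
        ; below   = λ {v} σ< → true-below 𝒟 (assign x v ℐ)
            (≡.subst (λ σ → BelowNeg κ σ k) (sym (value v)) σ<)
        }
        where
        value : ∀ v → evalLin (assign x v ℐ) (term (c · x ⊞ s)) ≡
                      add κ (mul κ (proj₁ c) v) (evalLin ℐ (term s))
        value v = cong₂ (λ w σ → add κ (mul κ (proj₁ c) w) σ) (assign-same ℐ x v)
          (sym (evalLin-cong (term s) (assign-agree ℐ x v ∉term)))

    -- Other variables zs of the same kind may change along with those of s: by only-vars they
    -- do not occur in F.
    At-monotone : ∀ {𝒟} {ℐ ℐ′ : Interpretation 𝒟} zs → (∀ {y} → y ∈ vars s → y ∈ zs) →
      (∀ {f} → f ∈ map (varSymbol κ) zs → IsIneqAux f) →
      (∀ f → f ∉ map (varSymbol κ) zs → ∀ vs → ℐ f vs ≡ ℐ′ f vs) → _≤[_]_ {κ = κ} ℐ′ zs ℐ →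
      ∀ {v} → At x F ℐ v → At x F ℐ′ v
    At-monotone {ℐ = ℐ} {ℐ′} zs s⊆zs zs-aux agree ℐ′≤ℐ {v} = monotone-on-symb {ys = x ∷ vars s} {F} monotone
      (λ f f∈F f∉ → assign-agree-off ℐ ℐ′ x v v f (λ f≡x → f∉ (here f≡x)) (agree f
        λ f∈zs → f∉ (only-vars f (zs-aux f∈zs) (∈-++⁺ʳ (symbolsLin (term (c · x ⊞ s))) f∈F))))
      (assign-≤ x (Leq-refl κ refl) λ y y∈ → ℐ′≤ℐ y (s⊆zs y∈))

  module Resolvent {κ} {x₁ x₂} {c₁ c₂ : Num⁺ κ} {s₁ s₂ : Lin⁺ κ} {k₁ k₂ F₁ F₂}
    (wf₁ : WellFormed (LA (c₁ · x₁ ⊞ s₁) k₁ F₁)) (wf₂ : WellFormed (LA (c₂ · x₂ ⊞ s₂) k₂ F₂))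
    (x₁∉s₁ : x₁ ∉ vars s₁) (x₂∉s₂ : x₂ ∉ vars s₂) where

    P₁ P₂ P₃ : Pattern
    P₁ = LA (c₁ · x₁ ⊞ s₁) k₁ F₁
    P₂ = LA (c₂ · x₂ ⊞ s₂) k₂ F₂
    P₃ = LA (s₃ c₁ c₂ s₁ s₂) (k₃ κ c₁ c₂ k₁ k₂) (F₃ κ x₁ x₂ c₁ c₂ s₁ s₂ k₁ F₁ F₂)

    module _ {𝒟} (ℐ : Interpretation 𝒟) where
      private
        cut₁ = pattern-cut wf₁ x₁∉s₁ ℐ
        cut₂ = pattern-cut wf₂ x₂∉s₂ ℐ

      eliminated⁻ : satisfies ℐ (Pattern.formula P₃) → Eliminated κ x₁ x₂ F₁ F₂ ℐ
      eliminated⁻ = F₃-sound ℐ κ x₁ x₂ c₁ c₂ s₁ s₂ k₁ k₂ F₁ F₂ cut₁ cut₂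

      eliminated⁺ : Eliminated κ x₁ x₂ F₁ F₂ ℐ → satisfies ℐ (Pattern.formula P₃)
      eliminated⁺ = F₃-complete ℐ κ x₁ x₂ c₁ c₂ s₁ s₂ k₁ k₂ F₁ F₂ cut₁ cut₂

    linear-part : ∀ {f} → f ∈ symbolsLin (term s₁) ⊎ f ∈ symbolsLin (term s₂) →
      (f ∈ symbPattern P₁ × f ≢ varSymbol κ x₁) ⊎ (f ∈ symbPattern P₂ × f ≢ varSymbol κ x₂)
    linear-part = Sum.map (λ f∈₁ → ∈-++⁺ˡ (there f∈₁) , λ { refl → ∉term wf₁ x₁∉s₁ f∈₁ })
                          (λ f∈₂ → ∈-++⁺ˡ (there f∈₂) , λ { refl → ∉term wf₂ x₂∉s₂ f∈₂ })

    symbols-resolvent : ∀ {f} → f ∈ symbPattern P₃ →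
      (f ∈ symbPattern P₁ × f ≢ varSymbol κ x₁) ⊎ (f ∈ symbPattern P₂ × f ≢ varSymbol κ x₂)
    symbols-resolvent {f} f∈ with ∈-++⁻ (symbolsLin (term (s₃ c₁ c₂ s₁ s₂))) f∈
    ... | inj₁ f∈s₃ = linear-part (term-s₃⁻ c₁ c₂ s₁ s₂ f∈s₃)
    ... | inj₂ f∈F₃ with symb-F₃ κ x₁ x₂ c₁ c₂ s₁ s₂ k₁ F₁ F₂ f∈F₃
    ...   | inj₁ f∈F = Sum.map (Product.map₁ (∈-++⁺ʳ (symbolsLin (term (c₁ · x₁ ⊞ s₁)))))
                               (Product.map₁ (∈-++⁺ʳ (symbolsLin (term (c₂ · x₂ ⊞ s₂))))) f∈F
    ...   | inj₂ f∈s = linear-part f∈s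

    ys₁ ys₂ ys₃ : List Symbol
    ys₁ = map (varSymbol κ) (vars s₁)
    ys₂ = map (varSymbol κ) (vars s₂)
    ys₃ = map (varSymbol κ) (vars (s₃ c₁ c₂ s₁ s₂))

    ys₃⁻ : ∀ {f} → f ∈ ys₃ → f ∈ ys₁ ⊎ f ∈ ys₂
    ys₃⁻ {f} f∈ = ∈-++⁻ ys₁ (≡.subst (f ∈_) (vars-s₃ c₁ c₂ s₁ s₂) f∈)

    ys₃⁺ : ∀ {f} → f ∈ ys₁ ⊎ f ∈ ys₂ → f ∈ ys₃
    ys₃⁺ {f} = ≡.subst (f ∈_) (sym (vars-s₃ c₁ c₂ s₁ s₂)) ∘ [ ∈-++⁺ˡ , ∈-++⁺ʳ ys₁ ]′

    ys₃-aux : ∀ {f} → f ∈ ys₃ → IsIneqAux f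
    ys₃-aux f∈ = [ vars⇒IneqAux wf₁ , vars⇒IneqAux wf₂ ]′ (ys₃⁻ f∈)

    var-name : ∀ {y ys} → varSymbol κ y ∈ map (varSymbol κ) ys → y ∈ ys
    var-name {ys = ys} y∈ with z , z∈ , y≡z ← ∈-map⁻ (varSymbol κ) y∈ =
      ≡.subst (_∈ ys) (sym (varSymbol-injective y≡z)) z∈

    -- Covers the variables of the other pattern too: one that occurs in the remainder of s
    -- would have to be a variable of this pattern, by only-vars.
    rest-avoids : ∀ {f} {c : Num⁺ κ} {x s k F} → WellFormed (LA (c · x ⊞ s) k F) → IsIneqAux f →
      f ∉ symbolsLin (rest s)
    rest-avoids {f} {s = s} wf aux f∈ = WellFormed.rest-free wf f
      (WellFormed.only-vars wf f aux (∈-++⁺ˡ (there (symbols-rest⁺ s f∈)))) f∈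

    drop-head : ∀ {f g : Symbol} {fs} → f ∈ g ∷ fs → f ≢ g → f ∈ fs
    drop-head (here f≡g) f≢g = contradiction f≡g f≢g
    drop-head (there f∈) _   = f∈

    resolvent-monotone : Monotone κ (vars (s₃ c₁ c₂ s₁ s₂)) (Pattern.formula P₃)
    resolvent-monotone 𝒟 ℐ ℐ′ agree ℐ′≤ℐ f₃ with v , p₁ , p₂ ← eliminated⁻ ℐ f₃ =
      eliminated⁺ ℐ′ (v , At-monotone wf₁ zs (λ y∈ → var-name (ys₃⁺ (inj₁ (∈-map⁺ (varSymbol κ) y∈)))) ys₃-aux agree ℐ′≤ℐ p₁
                        , At-monotone wf₂ zs (λ y∈ → var-name (ys₃⁺ (inj₂ (∈-map⁺ (varSymbol κ) y∈)))) ys₃-aux agree ℐ′≤ℐ p₂)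
      where zs = vars (s₃ c₁ c₂ s₁ s₂)

    resolvent-wellFormed : WellFormed P₃
    resolvent-wellFormed = record
      { vars-aux     = All.tabulate ys₃-aux
      ; only-vars    = λ f aux f∈ → ys₃⁺ (Sum.map
          (λ (f∈₁ , f≢x₁) → drop-head (WellFormed.only-vars wf₁ f aux f∈₁) f≢x₁)
          (λ (f∈₂ , f≢x₂) → drop-head (WellFormed.only-vars wf₂ f aux f∈₂) f≢x₂)
          (symbols-resolvent f∈))
      ; rest-free    = λ f f∈ys f∈rest → [ rest-avoids wf₁ (ys₃-aux f∈ys) , rest-avoids wf₂ (ys₃-aux f∈ys) ]′
          (rest-s₃⁻ c₁ c₂ s₁ s₂ f∈rest)
      ; offset-range = k₃-range κ c₁ c₂ (WellFormed.offset-range wf₁) (WellFormed.offset-range wf₂)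
      ; monotone     = resolvent-monotone
      ; false-above  = λ 𝒟 ℐ 0<s₃ f₃ → Leq⇒≮ κ
          (F₃-false-above ℐ κ x₁ x₂ c₁ c₂ s₁ s₂ k₁ k₂ F₁ F₂ (pattern-cut wf₁ x₁∉s₁ ℐ) (pattern-cut wf₂ x₂∉s₂ ℐ) f₃) 0<s₃
      ; true-below   = λ 𝒟 ℐ → F₃-true-below ℐ κ x₁ x₂ c₁ c₂ s₁ s₂ k₁ k₂ F₁ F₂
          (pattern-cut wf₁ x₁∉s₁ ℐ) (pattern-cut wf₂ x₂∉s₂ ℐ)
      }

-- Projections and the premises of the resolution step

module Projections (𝒮 : Setting) where
  open Setting 𝒮

  orient-symbols : ∀ {σ} (t u : Term (val σ)) → let a , b = orient t u in
    symbols a ⊆ symbols t ++ symbols u × symbols b ⊆ symbols t ++ symbols u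
  orient-symbols t u with locality (symbols t)
  ... | A-local = ∈-++⁺ˡ , ∈-++⁺ʳ (symbols t)
  ... | B-local = ∈-++⁺ʳ (symbols t) , ∈-++⁺ˡ
  ... | shared  = ∈-++⁺ʳ (symbols t) , ∈-++⁺ˡ
  ... | mixed   = ∈-++⁺ʳ (symbols t) , ∈-++⁺ˡ

  Within : Literal → List Aux → Formula → Set
  Within ℓ ks φ = ∀ {f} → f ∈ symb φ → f ∈ symbolsLit ℓ ⊎ f ∈ map auxSymbol ks

  Within-xor : ∀ {ℓ ks φ ψ} → Within ℓ ks φ → Within ℓ ks ψ → Within ℓ ks (φ xorᶠ ψ)
  Within-xor {φ = φ} {ψ} inφ inψ f∈ with ∈-++⁻ (symb φ ++ symb ψ) f∈
  ... | inj₁ f∈ˡ = [ inφ , inψ ]′ (∈-++⁻ (symb φ) f∈ˡ)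
  ... | inj₂ f∈ʳ = [ inφ , inψ ]′ (∈-++⁻ (symb φ) f∈ʳ)

  A-mixed-symbols : ∀ ℓ → Within ℓ (mixedAux ℓ) (A-mixed ℓ)
  A-mixed-symbols (s ≤ˡ c) f∈ = Sum.map (symbolsLin-filter hasALocal? s) id (symbolsLin-++⁻ (A-part s) _ f∈)
  A-mixed-symbols (t ≐ u) f∈ =
    Sum.map₁ (proj₁ (orient-symbols t u)) (∈-++⁻ (symbols (proj₁ (orient t u))) f∈)
  A-mixed-symbols (t ≭ u) = let a , b = orient t u in
    Within-xor {t ≭ u} {mixedAux (t ≭ u)} {lit (atom (var _))} {lit (a ≐ var _)}
      (λ { (here f≡) → inj₂ (there (here f≡)) })
      (λ f∈ → Sum.map (proj₁ (orient-symbols t u)) (λ { (here f≡) → here f≡ }) (∈-++⁻ (symbols a) f∈))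

  B-mixed-symbols : ∀ ℓ → Within ℓ (mixedAux ℓ) (B-mixed ℓ)
  B-mixed-symbols (s ≤ˡ c) (here f≡)  = inj₂ (here f≡)
  B-mixed-symbols (s ≤ˡ c) (there f∈) = inj₁ (symbolsLin-filter (λ m → ¬? (hasALocal? m)) s f∈)
  B-mixed-symbols (t ≐ u) (here f≡)  = inj₂ (here f≡)
  B-mixed-symbols (t ≐ u) (there f∈) = inj₁ (proj₂ (orient-symbols t u) f∈)
  B-mixed-symbols (t ≭ u) = let a , b = orient t u in
    Within-xor {t ≭ u} {mixedAux (t ≭ u)} {¬ᶠ lit (atom (var _))} {lit (var _ ≐ b)}
      (λ { (here f≡) → inj₂ (there (here f≡)) })
      (λ { (here f≡) → inj₂ (here f≡) ; (there f∈) → inj₁ (proj₂ (orient-symbols t u) f∈) })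

  projectA-symbols : ∀ L ℓ → Within ℓ (introduced L ℓ) (projectA L ℓ)
  projectA-symbols A-local ℓ f∈ = inj₁ f∈
  projectA-symbols shared  ℓ f∈ with scheme
  ... | Pudlák = inj₁ f∈
  projectA-symbols mixed   ℓ f∈ = A-mixed-symbols ℓ f∈

  projectB-symbols : ∀ L ℓ → Within ℓ (introduced L ℓ) (projectB L ℓ)
  projectB-symbols B-local ℓ f∈ = inj₁ f∈
  projectB-symbols shared  ℓ f∈ = inj₁ f∈
  projectB-symbols mixed   ℓ f∈ = B-mixed-symbols ℓ f∈

  ineq-injective : ∀ {κ s c κ′ s′ c′} → ineq {κ} s c ≡ ineq {κ′} s′ c′ → (s ≤ˡ c) ≡ (s′ ≤ˡ c′)
  ineq-injective refl = refl

  -- Distinct names identify the literal that an inequality auxiliary variable belongs to.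
  aux-owner : ∀ {κ} {s : Lin κ} {c} L ℓ → auxSymbol (ineq s c) ∈ map auxSymbol (introduced L ℓ) → (s ≤ˡ c) ≡ ℓ
  aux-owner mixed (s ≤ˡ c) (here f≡) = ineq-injective (auxName-distinct (cong name f≡))
  aux-owner mixed (t ≐ u) (here f≡) with () ← auxName-distinct (cong name f≡)
  aux-owner mixed (t ≭ u) (here f≡) with () ← auxName-distinct (cong name f≡)
  aux-owner mixed (t ≭ u) (there (here f≡)) with () ← auxName-distinct (cong name f≡)

  OverAB : List Symbol → Set
  OverAB = All (λ f → f ∈ symb A ⊎ f ∈ symb B)

  aux-fresh : ∀ {k fs} → OverAB fs → auxSymbol k ∉ fs
  aux-fresh {k} over x∈ = [ proj₁ (fresh k) , proj₂ (fresh k) ]′ (All.lookup over x∈)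

  -- One premise of the step, for a literal p whose negation s ≤ c has the auxiliary variable
  -- x.  Neither A, B nor the projections of the rest C of the clause mention x, so a model
  -- of these can be given any value of x.
  module Premise {κ} (s : Lin κ) (c : Bound κ) (s-mixed : Mixed (s ≤ˡ c)) (s-over : OverAB (symbolsLin s))
    {p} (~p≡ : ~ p ≡ s ≤ˡ c) {C : Clause} (C-projectable : All Projectable C) (p∉C : p ∉ C) {J} (itp : PartialInterpolant (p ∷ C) J) where

    open PartialInterpolant itp

    x : ℕ
    x = auxName (ineq s c)

    clauseA clauseB : Formula
    clauseA = ⋀ (map (λ ℓ → (~ ℓ) ↓A) C)
    clauseB = ⋀ (map (λ ℓ → (~ ℓ) ↓B) C)

    x∉clause : (project : Locality → Literal → Formula) →
      (∀ L ℓ → Within ℓ (introduced L ℓ) (project L ℓ)) →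
      varSymbol κ x ∉ symb (⋀ (map (λ ℓ → project (locality (symbolsLit (~ ℓ))) (~ ℓ)) C))
    x∉clause project within x∈ with ℓ , ℓ∈ , x∈ℓ ← symb-⋀-map⁻ _ C x∈ with within _ (~ ℓ) x∈ℓ
    ... | inj₁ x∈~ℓ = aux-fresh {ineq s c} (proj₁ (All.lookup C-projectable ℓ∈)) (≡.subst (varSymbol κ x ∈_) (symbolsLit-~ ℓ) x∈~ℓ)
    ... | inj₂ x∈aux = p∉C (≡.subst (_∈ C) (sym (~-injective
      (trans ~p≡ (aux-owner (locality (symbolsLit (~ ℓ))) (~ ℓ) x∈aux)))) ℓ∈)

    x∉s : varSymbol κ x ∉ symbolsLin s
    x∉s = aux-fresh {ineq s c} s-over

    module _ {𝒟} (ℐ : Interpretation 𝒟) where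

      a b : Num κ
      a = evalLin ℐ (A-part s)
      b = evalLin ℐ (B-part s)

      holds-A : satisfies (assign x (neg κ a) ℐ) ((s ≤ˡ c) ↓A)
      holds-A = ≡.subst (λ L → satisfies (assign x (neg κ a) ℐ) (projectA L (s ≤ˡ c))) (sym s-mixed)
        (AtMost-0ᵇ κ (trans (evalLin-++ ℐ′ (A-part s) _) (trans (cong₂ (add κ)
          (sym (evalLin-cong (A-part s) (assign-agree ℐ x _ (x∉s ∘ symbolsLin-filter hasALocal? s))))
          (trans (+-identityʳ _) (trans (*-identityˡ _) (assign-same ℐ x (neg κ a)))))
          (-‿inverseʳ a))))
        where ℐ′ = assign x (neg κ a) ℐ

      holds-B : ∀ {v} → AtMost κ (add κ (neg κ v) b) c → satisfies (assign x v ℐ) ((s ≤ˡ c) ↓B)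
      holds-B {v} v≤ = ≡.subst (λ L → satisfies (assign x v ℐ) (projectB L (s ≤ˡ c))) (sym s-mixed)
        (≡.subst (λ w → AtMost κ w c) (cong₂ (add κ)
          (sym (trans (-1*x≈-x _) (cong (neg κ) (assign-same ℐ x v))))
          (evalLin-cong (B-part s) (assign-agree ℐ x v (x∉s ∘ symbolsLin-filter _ s)))) v≤)

      -- The projection a + x ≤ 0 holds with equality for x = - a.
      implied : satisfies ℐ A → satisfies ℐ clauseA → satisfies (assign x (neg κ a) ℐ) ⌊ J ⌋
      implied hA hC = A⊨I 𝒟 (assign x (neg κ a) ℐ)
        ( transfer A (assign-agree ℐ x _ (proj₁ (fresh (ineq s c)))) hA
        , ≡.subst (λ ℓ → satisfies (assign x (neg κ a) ℐ) (ℓ ↓A)) (sym ~p≡) holds-A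
        , transfer clauseA (assign-agree ℐ x _ (x∉clause projectA projectA-symbols)) hC )

      refuted : satisfies ℐ B → satisfies ℐ clauseB → ∀ v → AtMost κ (add κ (neg κ v) b) c →
        ¬ satisfies (assign x v ℐ) ⌊ J ⌋
      refuted hB hC v v≤ hJ = B⊨¬I 𝒟 (assign x v ℐ)
        ( transfer B (assign-agree ℐ x v (proj₂ (fresh (ineq s c)))) hB
        , ( ≡.subst (λ ℓ → satisfies (assign x v ℐ) (ℓ ↓B)) (sym ~p≡) (holds-B v≤)
          , transfer clauseB (assign-agree ℐ x v (x∉clause projectB projectB-symbols)) hC )
        , hJ )

    symbols-shared : ∀ {f} → f ∈ symbInterpolant J → f ≢ varSymbol κ x →
      IsShared f ⊎ f ∈ concatMap (λ ℓ → auxSymbols (~ ℓ)) C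
    symbols-shared {f} f∈ f≢x with vocabulary f f∈
    ... | inj₁ f-shared = inj₁ f-shared
    ... | inj₂ f∈aux with ∈-++⁻ (auxSymbols (~ p)) f∈aux
    ...   | inj₂ f∈C = inj₂ f∈C
    ...   | inj₁ f∈p = contradiction (only-x (≡.subst (λ ℓ → f ∈ auxSymbols ℓ) ~p≡ f∈p)) f≢x
      where
      only-x : f ∈ auxSymbols (s ≤ˡ c) → f ≡ varSymbol κ x
      only-x f∈ with here f≡ ← ≡.subst (λ L → f ∈ map auxSymbol (introduced L (s ≤ˡ c))) s-mixed f∈ = f≡

  A-part-negate : ∀ {κ} (s : Lin κ) → A-part (negate κ s) ≡ negate κ (A-part s)
  A-part-negate s = filter-map hasALocal? _ s

  B-part-negate : ∀ {κ} (s : Lin κ) → B-part (negate κ s) ≡ negate κ (B-part s)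
  B-part-negate s = filter-map (λ m → ¬? (hasALocal? m)) _ s

-- The resolution step

theorem3 :
    (𝒮 : Setting) →
    let open Setting 𝒮 in
    ∀ {κ} (s : Lin κ) (c : Bound κ) →
    let pivot = s ≤ˡ c
        x₁ = auxName (ineq (negate κ s) (negBound κ c))
        x₂ = auxName (ineq s c)
    in
    Mixed pivot → Projectable pivot →
    (C₁ C₂ : Clause) → All Projectable C₁ → All Projectable C₂ →
    pivot ∉ C₁ → (~ pivot) ∉ C₁ → pivot ∉ C₂ → (~ pivot) ∉ C₂ →
    (I₁ I₂ : Context) (c₁ c₂ : Num⁺ κ) (s₁ s₂ : Lin⁺ κ) (k₁ k₂ : Offset κ) (F₁ F₂ : Formula) →
    HoleOccurs I₁ → HoleOccurs I₂ →
    x₁ ∉ vars s₁ → x₂ ∉ vars s₂ →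
    varSymbol κ x₁ ∉ symbContext I₁ → varSymbol κ x₂ ∉ symbContext I₂ →
    let J₁ = I₁ [ leaf (LA (c₁ · x₁ ⊞ s₁) k₁ F₁) ]
        J₂ = I₂ [ leaf (LA (c₂ · x₂ ⊞ s₂) k₂ F₂) ]
        J₃ = I₁ [ I₂ [ leaf (LA (s₃ c₁ c₂ s₁ s₂) (k₃ κ c₁ c₂ k₁ k₂) (F₃ κ x₁ x₂ c₁ c₂ s₁ s₂ k₁ F₁ F₂)) ] ]
    in
    Patterned J₁ → PartialInterpolant (pivot ∷ C₁) J₁ →
    Patterned J₂ → PartialInterpolant ((~ pivot) ∷ C₂) J₂ →
    Patterned J₃ × PartialInterpolant (C₁ ++ C₂) J₃
theorem3 𝒮 {κ} s c s-mixed s-projectable C₁ C₂ C₁-projectable C₂-projectable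
  pivot∉C₁ _ _ ~pivot∉C₂ I₁ I₂ c₁ c₂ s₁ s₂ k₁ k₂ F₁ F₂ hole₁ hole₂ x₁∉s₁ x₂∉s₂ x₁∉I₁ x₂∉I₂
  patterned₁ itp₁ patterned₂ itp₂ = patterned , record { A⊨I = A-side ; B⊨¬I = B-side ; vocabulary = λ _ → vocabulary₃ }
  where
  open Setting 𝒮
  open Projections 𝒮
  open Patterned
  pivot = s ≤ˡ c

  negated-mixed : Mixed (~ pivot)
  negated-mixed = trans (cong locality (symbolsLin-negate s)) s-mixed

  s-over : OverAB (symbolsLin s)
  s-over = proj₁ s-projectable

  module Side₁ = Premise (negate κ s) (negBound κ c) negated-mixed
    (≡.subst OverAB (sym (symbolsLin-negate s)) s-over) refl C₁-projectable pivot∉C₁ itp₁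
  module Side₂ = Premise s c s-mixed s-over (~-involutive pivot) C₂-projectable ~pivot∉C₂ itp₂

  wf₁ : WellFormed (LA (c₁ · Side₁.x ⊞ s₁) k₁ F₁)
  wf₁ = All.lookup (well-formed patterned₁) (leaves-plug⁺ I₁ (inj₂ (hole₁ , here refl)))
  wf₂ : WellFormed (LA (c₂ · Side₂.x ⊞ s₂) k₂ F₂)
  wf₂ = All.lookup (well-formed patterned₂) (leaves-plug⁺ I₂ (inj₂ (hole₂ , here refl)))
  open Patterns.Resolvent 𝒮 wf₁ wf₂ x₁∉s₁ x₂∉s₂

  J₃ : Interpolant
  J₃ = I₁ [ I₂ [ leaf P₃ ] ]

  patterned : Patterned J₃
  patterned = record
    { well-formed = All.tabulate λ P∈ → [ (λ P∈₁ → All.lookup (well-formed patterned₁) (leaves-plug⁺ I₁ (inj₁ P∈₁)))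
        , (λ P∈ → [ (λ P∈₂ → All.lookup (well-formed patterned₂) (leaves-plug⁺ I₂ (inj₁ P∈₂)))
                  , (λ { (here refl) → resolvent-wellFormed }) ]′ (leaves-plug⁻ I₂ P∈)) ]′ (leaves-plug⁻ I₁ P∈)
    ; only-inside = λ f aux f∈ → let ℓ , ℓ∈ , f∈ℓ = find (∈-concatMap⁻ symbolsLit {xs = literals J₃} f∈) in
        [ (λ ℓ∈₁ → only-inside patterned₁ f aux (concatMap∈ symbolsLit (literals-plug⁺ I₁ ℓ∈₁) f∈ℓ))
        , (λ ℓ∈ → [ (λ ℓ∈₂ → only-inside patterned₂ f aux (concatMap∈ symbolsLit (literals-plug⁺ I₂ ℓ∈₂) f∈ℓ))
                  , (λ ()) ]′ (literals-plug⁻ I₂ ℓ∈)) ]′ (literals-plug⁻ I₁ ℓ∈)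
    }

  from₁ : ∀ {f} → f ∈ symbInterpolant (I₁ [ leaf P₁ ]) × f ≢ varSymbol κ Side₁.x →
    IsShared f ⊎ f ∈ concatMap (λ ℓ → auxSymbols (~ ℓ)) (C₁ ++ C₂)
  from₁ (f∈ , f≢) = Sum.map₂ (concatMap⁺ _ (xs⊆xs++ys C₁ C₂)) (Side₁.symbols-shared f∈ f≢)

  from₂ : ∀ {f} → f ∈ symbInterpolant (I₂ [ leaf P₂ ]) × f ≢ varSymbol κ Side₂.x →
    IsShared f ⊎ f ∈ concatMap (λ ℓ → auxSymbols (~ ℓ)) (C₁ ++ C₂)
  from₂ (f∈ , f≢) = Sum.map₂ (concatMap⁺ _ (xs⊆ys++xs C₂ C₁)) (Side₂.symbols-shared f∈ f≢)

  vocabulary₃ : ∀ {f} → f ∈ symbInterpolant J₃ → IsShared f ⊎ f ∈ concatMap (λ ℓ → auxSymbols (~ ℓ)) (C₁ ++ C₂)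
  vocabulary₃ {f} f∈ with symbInterpolant-plug⁻ I₁ f∈
  ... | inj₁ f∈I₁ = from₁ (symbContext-plug⁺ I₁ f∈I₁ , λ { refl → x₁∉I₁ f∈I₁ })
  ... | inj₂ f∈ with symbInterpolant-plug⁻ I₂ f∈
  ...   | inj₁ f∈I₂ = from₂ (symbContext-plug⁺ I₂ f∈I₂ , λ { refl → x₂∉I₂ f∈I₂ })
  ...   | inj₂ f∈P₃ = [ from₁ ∘ Product.map₁ (symbPattern-plug⁺ I₁ hole₁)
                      , from₂ ∘ Product.map₁ (symbPattern-plug⁺ I₂ hole₂) ]′
                        (symbols-resolvent (≡.subst (f ∈_) (++-identityʳ (symbPattern P₃)) f∈P₃))

  A-side : A ∧ᶠ ⋀ (map (λ ℓ → (~ ℓ) ↓A) (C₁ ++ C₂)) ⊨ ⌊ J₃ ⌋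
  A-side 𝒟 ℐ (hA , hC) =
    plug I₁ (AgreeOn-sym (assign-agree ℐ Side₁.x a x₁∉I₁))
      (λ p₁ → plug I₂ (AgreeOn-sym (assign-agree ℐ Side₂.x (neg κ a) x₂∉I₂))
        (λ p₂ → eliminated⁺ ℐ (a , p₁ , p₂)) h₂) h₁
    where
    -- The A-part of the pivot: its projections require a + x₂ ≤ 0 and - a + x₁ ≤ 0.
    a = Side₂.a ℐ
    x₁-value : neg κ (Side₁.a ℐ) ≡ a
    x₁-value = trans (cong (neg κ) (trans (cong (evalLin ℐ) (A-part-negate s)) (evalLin-negate ℐ (A-part s))))
      (-‿involutive a)
    clauses = ⋀-++⁻ ℐ (λ ℓ → (~ ℓ) ↓A) C₁ hC
    h₁ = ≡.subst (λ v → satisfies (assign Side₁.x v ℐ) ⌊ I₁ [ leaf P₁ ] ⌋) x₁-value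
           (Side₁.implied ℐ hA (proj₁ clauses))
    h₂ = Side₂.implied ℐ hA (proj₂ clauses)

  B-side : B ∧ᶠ (⋀ (map (λ ℓ → (~ ℓ) ↓B) (C₁ ++ C₂)) ∧ᶠ ⌊ J₃ ⌋) ⊨ ⊥ᶠ
  B-side 𝒟 ℐ (hB , hC , h₃) = by-inner (satisfies? ℐ ⌊ I₂ [ leaf P₃ ] ⌋)
    where
    b = Side₂.b ℐ
    clauses = ⋀-++⁻ ℐ (λ ℓ → (~ ℓ) ↓B) C₁ hC
    b-negate : Side₁.b ℐ ≡ neg κ b
    b-negate = trans (cong (evalLin ℐ) (B-part-negate s)) (evalLin-negate ℐ (B-part s))

    refute₁ : ∀ v → AtMost κ (add κ (neg κ v) (Side₁.b ℐ)) (negBound κ c) →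
      ¬ (satisfies ℐ ⌊ I₂ [ leaf P₃ ] ⌋ → At Side₁.x F₁ ℐ v)
    refute₁ v v≤ imp = Side₁.refuted ℐ hB (proj₁ clauses) v v≤ (plug I₁ (assign-agree ℐ Side₁.x v x₁∉I₁) imp h₃)

    refute₂ : ∀ v → AtMost κ (add κ (neg κ v) b) c → satisfies ℐ ⌊ I₂ [ leaf P₃ ] ⌋ →
      ¬ (satisfies ℐ (Pattern.formula P₃) → At Side₂.x F₂ ℐ v)
    refute₂ v v≤ h imp = Side₂.refuted ℐ hB (proj₂ clauses) v v≤ (plug I₂ (assign-agree ℐ Side₂.x v x₂∉I₂) imp h)

    -- x₂ = - v satisfies the B-projection - x₂ + b ≤ c of the pivot, or else x₁ = v satisfies
    -- that of its negation.
    by-cut : satisfies ℐ ⌊ I₂ [ leaf P₃ ] ⌋ → ∀ {v} → At Side₁.x F₁ ℐ v → At Side₂.x F₂ ℐ (neg κ v) →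
      ¬ Dec (AtMost κ (add κ v b) c)
    by-cut h {v} p₁ p₂ (yes v+b≤c) = refute₂ (neg κ v)
      (≡.subst (λ w → AtMost κ (add κ w b) c) (sym (-‿involutive v)) v+b≤c) h (λ _ → p₂)
    by-cut h {v} p₁ p₂ (no v+b≰c) = refute₁ v
      (≡.subst (λ w → AtMost κ w (negBound κ c))
        (trans (sym (-‿+-comm v b)) (cong (add κ (neg κ v)) (sym b-negate))) (AtMost-neg κ c v+b≰c)) (λ _ → p₁)

    by-resolvent : satisfies ℐ ⌊ I₂ [ leaf P₃ ] ⌋ → ¬ Dec (satisfies ℐ (Pattern.formula P₃))
    by-resolvent h (yes f₃) = let v , p₁ , p₂ = eliminated⁻ ℐ f₃ in by-cut h p₁ p₂ (AtMost? κ (add κ v b) c)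
    by-resolvent h (no ¬f₃) = let v , v≤ = AtMost-slack κ b c in refute₂ v v≤ h (λ f₃ → contradiction f₃ ¬f₃)

    by-inner : ¬ Dec (satisfies ℐ ⌊ I₂ [ leaf P₃ ] ⌋)
    by-inner (yes h) = by-resolvent h (satisfies? ℐ (Pattern.formula P₃))
    by-inner (no ¬h) = let v , v≤ = AtMost-slack κ (Side₁.b ℐ) (negBound κ c) in
      refute₁ v v≤ (λ h → contradiction h ¬h)
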